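{- The following hold: (i) The set of all quadratic algebraic integers in $\mathbb{R}$ is equal to the disjoint union $$\biguplus_{n \in \mathbb{Z},\ \varepsilon \in \{ -1,+1\}} \left(\varepsilon S^{2,r} + n\right)$$ (that is, it is the union of these sets, and the sets $\varepsilon S^{2,r}+n$ for distinct pairs $(n,\varepsilon)$ are pairwise disjoint). (ii) In particular, $S^{2,r}$ includes a primitive element (over $\mathbb{Q}$) of any real quadratic field.
   Context: A quadratic algebraic integer is an algebraic integer of degree exactly two over $\mathbb{Q}$. A real quadratic field is a subfield of $\mathbb{R}$ of degree two over $\mathbb{Q}$. For an integer $n \ge 1$, $$I_n^{2,r} := \{\alpha \in (0,1) \mid \alpha^2+n\alpha+c=0 \text{ for some } c \in \mathbb{Z},\ -n \le c \le -1\},$$ and $$S^{2,r} := \bigcup_{n \ge 1} I_n^{2,r}.$$ For a set $S \subset \mathbb{C}$ and an integer $n$: $+S := S$, $-S := \{ -\alpha \mid \alpha \in S\}$ and $S+n := \{\alpha+n \mid \alpha \in S\}$; $\varepsilon S$ means $+S$ for $\varepsilon=+1$ and $-S$ for $\varepsilon=-1$. -}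

module Defs where

open import Data.Fin using (Fin)
open import Data.Integer as ℤ using (ℤ; 1ℤ; -1ℤ)
open import Data.Nat as ℕ using (ℕ; _⊔_)
import Data.Nat.Properties as ℕ
open import Data.Product using (Σ-syntax; ∃-syntax; _×_; _,_; proj₁; proj₂)
open import Data.Rational as ℚ using (ℚ; 0ℚ; 1ℚ; ½; ∣_∣)
import Data.Rational.Properties as ℚ
open import Data.Rational.Solver using (module +-*-Solver)
open import Data.Sign as Sign using (Sign)
open import Data.Vec using (Vec; []; _∷_; map; lookup; replicate)
open import Level using (Level; 0ℓ)
open import Relation.Binary.PropositionalEquality
  using (_≡_; refl; sym; trans; cong; subst)
open import Relation.Nullary using (¬_)
open import Relation.Unary using (Pred; _∈_; _≐_)

-- Real numbers: Cauchy sequences of rationals, each with a modulus,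
-- compared by the setoid equality _≈_ (difference tends to 0).

IsCauchy : (ℕ → ℚ) → Set
IsCauchy x = ∀ ε → 0ℚ ℚ.< ε →
  ∃[ N ] (∀ m n → N ℕ.≤ m → N ℕ.≤ n → ∣ x m ℚ.- x n ∣ ℚ.< ε)

record ℝ : Set where
  constructor mkℝ
  field
    seq    : ℕ → ℚ
    cauchy : IsCauchy seq

open ℝ public

infix 4 _≈_ _<_

-- A record rather than a function type, so that x and y can be inferred.
record _≈_ (x y : ℝ) : Set where
  constructor mk≈
  field
    close : ∀ ε → 0ℚ ℚ.< ε →
      ∃[ N ] (∀ n → N ℕ.≤ n → ∣ seq x n ℚ.- seq y n ∣ ℚ.< ε)

open _≈_ public

-- The gap ε has to be uniform: termwise inequality would only give ≤.
_<_ : ℝ → ℝ → Set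
x < y = ∃[ ε ] 0ℚ ℚ.< ε ×
  ∃[ N ] (∀ n → N ℕ.≤ n → seq x n ℚ.+ ε ℚ.< seq y n)

abstract
  halve : ∀ {ε} → 0ℚ ℚ.< ε → ∃[ δ ] 0ℚ ℚ.< δ × δ ℚ.+ δ ≡ ε
  halve {ε} 0<ε =
    ½ ℚ.* ε ,
    ℚ.*-monoʳ-<-pos ½ 0<ε ,
    trans (sym (ℚ.*-distribʳ-+ ε ½ ½)) (ℚ.*-identityˡ ε)

  +-positive : ∀ {p q} → 0ℚ ℚ.< p → 0ℚ ℚ.< q → 0ℚ ℚ.< p ℚ.+ q
  +-positive = ℚ.+-mono-<

  divide : ∀ {C ε} → 0ℚ ℚ.< C → 0ℚ ℚ.< ε → ∃[ δ ] 0ℚ ℚ.< δ × C ℚ.* δ ≡ ε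
  divide {C} {ε} 0<C 0<ε =
    1/C ℚ.* ε ,
    ℚ.positive⁻¹ (1/C ℚ.* ε)
      {{ℚ.pos*pos⇒pos 1/C {{ℚ.1/pos⇒pos C {{C>0}}}} ε {{ℚ.positive 0<ε}}}} ,
    trans (sym (ℚ.*-assoc C 1/C ε))
      (trans (cong (ℚ._* ε) (ℚ.*-inverseʳ C {{C≢0}})) (ℚ.*-identityˡ ε))
    where
    C>0 : ℚ.Positive C
    C>0 = ℚ.positive 0<C
    C≢0 : ℚ.NonZero C
    C≢0 = ℚ.pos⇒nonZero C {{C>0}}
    1/C : ℚ
    1/C = (ℚ.1/ C) {{C≢0}}

  +-close : ∀ a b c d {δ η} → ∣ a ℚ.- c ∣ ℚ.< δ → ∣ b ℚ.- d ∣ ℚ.< η →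
    ∣ (a ℚ.+ b) ℚ.- (c ℚ.+ d) ∣ ℚ.< δ ℚ.+ η
  +-close a b c d {δ} {η} p q = begin-strict
    ∣ (a ℚ.+ b) ℚ.- (c ℚ.+ d) ∣    ≡⟨ cong ∣_∣ regroup ⟩
    ∣ (a ℚ.- c) ℚ.+ (b ℚ.- d) ∣    ≤⟨ ℚ.∣p+q∣≤∣p∣+∣q∣ (a ℚ.- c) (b ℚ.- d) ⟩
    ∣ a ℚ.- c ∣ ℚ.+ ∣ b ℚ.- d ∣    <⟨ ℚ.+-mono-< p q ⟩
    δ ℚ.+ η                        ∎
    where
    open ℚ.≤-Reasoning
    open +-*-Solver
    regroup : (a ℚ.+ b) ℚ.- (c ℚ.+ d) ≡ (a ℚ.- c) ℚ.+ (b ℚ.- d)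
    regroup = solve 4 (λ a b c d →
      (a :+ b) :- (c :+ d) := (a :- c) :+ (b :- d)) refl a b c d

  *-small : ∀ a b {A δ} → 0ℚ ℚ.< A → ∣ a ∣ ℚ.< A → ∣ b ∣ ℚ.< δ →
    ∣ a ℚ.* b ∣ ℚ.< A ℚ.* δ
  *-small a b {A} {δ} 0<A p q = begin-strict
    ∣ a ℚ.* b ∣        ≡⟨ ℚ.∣p*q∣≡∣p∣*∣q∣ a b ⟩
    ∣ a ∣ ℚ.* ∣ b ∣    ≤⟨ ℚ.*-monoʳ-≤-nonNeg ∣ b ∣ {{ℚ.∣-∣-nonNeg b}} (ℚ.<⇒≤ p) ⟩
    A ℚ.* ∣ b ∣        <⟨ ℚ.*-monoʳ-<-pos A {{ℚ.positive 0<A}} q ⟩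
    A ℚ.* δ            ∎
    where open ℚ.≤-Reasoning

  *-close : ∀ a b c d {A B δ} → 0ℚ ℚ.< A → 0ℚ ℚ.< B →
    ∣ a ∣ ℚ.< A → ∣ d ∣ ℚ.< B → ∣ a ℚ.- c ∣ ℚ.< δ → ∣ b ℚ.- d ∣ ℚ.< δ →
    ∣ a ℚ.* b ℚ.- c ℚ.* d ∣ ℚ.< (A ℚ.+ B) ℚ.* δ
  *-close a b c d {A} {B} {δ} 0<A 0<B a<A d<B p q = begin-strict
    ∣ a ℚ.* b ℚ.- c ℚ.* d ∣
      ≡⟨ cong ∣_∣ regroup ⟩
    ∣ a ℚ.* (b ℚ.- d) ℚ.+ d ℚ.* (a ℚ.- c) ∣
      ≤⟨ ℚ.∣p+q∣≤∣p∣+∣q∣ (a ℚ.* (b ℚ.- d)) (d ℚ.* (a ℚ.- c)) ⟩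
    ∣ a ℚ.* (b ℚ.- d) ∣ ℚ.+ ∣ d ℚ.* (a ℚ.- c) ∣
      <⟨ ℚ.+-mono-< (*-small a (b ℚ.- d) 0<A a<A q)
                    (*-small d (a ℚ.- c) 0<B d<B p) ⟩
    A ℚ.* δ ℚ.+ B ℚ.* δ
      ≡⟨ sym (ℚ.*-distribʳ-+ δ A B) ⟩
    (A ℚ.+ B) ℚ.* δ ∎
    where
    open ℚ.≤-Reasoning
    open +-*-Solver
    regroup : a ℚ.* b ℚ.- c ℚ.* d ≡ a ℚ.* (b ℚ.- d) ℚ.+ d ℚ.* (a ℚ.- c)
    regroup = solve 4 (λ a b c d →
      (a :* b) :- (c :* d) := a :* (b :- d) :+ d :* (a :- c)) refl a b c d

  eventually-bounded : ∀ {x} → IsCauchy x →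
    ∃[ B ] 0ℚ ℚ.< B × ∃[ N ] (∀ n → N ℕ.≤ n → ∣ x n ∣ ℚ.< B)
  eventually-bounded {x} cx with cx 1ℚ (ℚ.positive⁻¹ 1ℚ)
  ... | N , near =
    1ℚ ℚ.+ ∣ x N ∣ ,
    ℚ.+-mono-<-≤ (ℚ.positive⁻¹ 1ℚ) (ℚ.0≤∣p∣ (x N)) ,
    N , λ n N≤n → begin-strict
      ∣ x n ∣                      ≡⟨ cong ∣_∣ (split (x n) (x N)) ⟩
      ∣ (x n ℚ.- x N) ℚ.+ x N ∣    ≤⟨ ℚ.∣p+q∣≤∣p∣+∣q∣ (x n ℚ.- x N) (x N) ⟩
      ∣ x n ℚ.- x N ∣ ℚ.+ ∣ x N ∣  <⟨ ℚ.+-monoˡ-< ∣ x N ∣ (near n N N≤n ℕ.≤-refl) ⟩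
      1ℚ ℚ.+ ∣ x N ∣               ∎
    where
    open ℚ.≤-Reasoning
    open +-*-Solver
    split : ∀ a b → a ≡ (a ℚ.- b) ℚ.+ b
    split = solve 2 (λ a b → a := (a :- b) :+ b) refl

  const-cauchy : ∀ q → IsCauchy (λ _ → q)
  const-cauchy q ε 0<ε = 0 , λ _ _ _ _ →
    subst (ℚ._< ε) (sym (cong ∣_∣ (ℚ.+-inverseʳ q))) 0<ε

  neg-cauchy : ∀ {x} → IsCauchy x → IsCauchy (λ n → ℚ.- x n)
  neg-cauchy {x} cx ε 0<ε = proj₁ (cx ε 0<ε) , λ m n p q →
    subst (ℚ._< ε)
      (trans (sym (ℚ.∣-p∣≡∣p∣ (x m ℚ.- x n)))
             (cong ∣_∣ (ℚ.neg-distrib-+ (x m) (ℚ.- x n))))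
      (proj₂ (cx ε 0<ε) m n p q)

  +-cauchy : ∀ {x y} → IsCauchy x → IsCauchy y →
             IsCauchy (λ n → x n ℚ.+ y n)
  +-cauchy {x} {y} cx cy ε 0<ε with halve 0<ε
  ... | δ , 0<δ , δ+δ≡ε with cx δ 0<δ | cy δ 0<δ
  ... | M , x-near | N , y-near = M ⊔ N , λ m n p q →
    subst (∣ (x m ℚ.+ y m) ℚ.- (x n ℚ.+ y n) ∣ ℚ.<_) δ+δ≡ε
      (+-close (x m) (y m) (x n) (y n)
        (x-near m n (ℕ.m⊔n≤o⇒m≤o M N p) (ℕ.m⊔n≤o⇒m≤o M N q))
        (y-near m n (ℕ.m⊔n≤o⇒n≤o M N p) (ℕ.m⊔n≤o⇒n≤o M N q)))

  *-cauchy : ∀ {x y} → IsCauchy x → IsCauchy y →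
             IsCauchy (λ n → x n ℚ.* y n)
  *-cauchy {x} {y} cx cy ε 0<ε =
    let A , 0<A , K , x<A = eventually-bounded cx
        B , 0<B , L , y<B = eventually-bounded cy
        δ , 0<δ , eq      = divide {A ℚ.+ B} {ε} (+-positive 0<A 0<B) 0<ε
        M , x-near        = cx δ 0<δ
        N , y-near        = cy δ 0<δ
    in (K ⊔ L) ⊔ (M ⊔ N) , λ m n p q →
      let p₂ = ℕ.m⊔n≤o⇒n≤o (K ⊔ L) (M ⊔ N) p
          q₂ = ℕ.m⊔n≤o⇒n≤o (K ⊔ L) (M ⊔ N) q
          x<A′ = x<A m (ℕ.m⊔n≤o⇒m≤o K L (ℕ.m⊔n≤o⇒m≤o (K ⊔ L) (M ⊔ N) p))
          y<B′ = y<B n (ℕ.m⊔n≤o⇒n≤o K L (ℕ.m⊔n≤o⇒m≤o (K ⊔ L) (M ⊔ N) q))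
          x-near′ = x-near m n (ℕ.m⊔n≤o⇒m≤o M N p₂) (ℕ.m⊔n≤o⇒m≤o M N q₂)
          y-near′ = y-near m n (ℕ.m⊔n≤o⇒n≤o M N p₂) (ℕ.m⊔n≤o⇒n≤o M N q₂)
      in subst (∣ x m ℚ.* y m ℚ.- x n ℚ.* y n ∣ ℚ.<_) eq
           (*-close (x m) (y m) (x n) (y n) {A} {B} {δ}
             0<A 0<B x<A′ y<B′ x-near′ y-near′)

infixl 6 _+_
infixl 7 _*_
infix  8 -_

fromℚ : ℚ → ℝ
fromℚ q = mkℝ (λ _ → q) (const-cauchy q)

ℤ→ℚ : ℤ → ℚ
ℤ→ℚ k = k ℚ./ 1

fromℤ : ℤ → ℝ
fromℤ k = fromℚ (ℤ→ℚ k)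

0ℝ 1ℝ : ℝ
0ℝ = fromℚ 0ℚ
1ℝ = fromℚ 1ℚ

_+_ : ℝ → ℝ → ℝ
x + y = mkℝ (λ n → seq x n ℚ.+ seq y n)
            (+-cauchy {seq x} {seq y} (cauchy x) (cauchy y))

-_ : ℝ → ℝ
- x = mkℝ (λ n → ℚ.- seq x n) (neg-cauchy {seq x} (cauchy x))

_*_ : ℝ → ℝ → ℝ
x * y = mkℝ (λ n → seq x n ℚ.* seq y n)
            (*-cauchy {seq x} {seq y} (cauchy x) (cauchy y))

-- Coefficients a₀ ∷ ⋯ ∷ a_{d-1} ∷ [] stand for the monic polynomial
-- a₀ + a₁ X + ⋯ + a_{d-1} X^{d-1} + X^d; the leading 1 is not stored.
evalMonic : ∀ {d} → Vec ℚ d → ℝ → ℝ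
evalMonic []      x = 1ℝ
evalMonic (a ∷ p) x = fromℚ a + x * evalMonic p x

_IsRootOf_ : ∀ {d} → ℝ → Vec ℚ d → Set
α IsRootOf p = evalMonic p α ≈ 0ℝ

IsAlgebraicInteger : Pred ℝ 0ℓ
IsAlgebraicInteger α = ∃[ d ] Σ[ p ∈ Vec ℤ d ] α IsRootOf (map ℤ→ℚ p)

-- The degree of the minimal polynomial of α over ℚ is d.
HasDegree : ℝ → ℕ → Set
HasDegree α d =
  (Σ[ p ∈ Vec ℚ d ] α IsRootOf p) ×
  (∀ e → e ℕ.< d → (p : Vec ℚ e) → ¬ (α IsRootOf p))

QuadraticInteger : Pred ℝ 0ℓ
QuadraticInteger α = IsAlgebraicInteger α × HasDegree α 2

I²ʳ : ℤ → Pred ℝ 0ℓ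
I²ʳ n α = (0ℝ < α × α < 1ℝ) ×
  ∃[ c ] (ℤ.- n ℤ.≤ c × c ℤ.≤ -1ℤ) ×
         α * α + fromℤ n * α + fromℤ c ≈ 0ℝ

S²ʳ : Pred ℝ 0ℓ
S²ʳ α = ∃[ n ] 1ℤ ℤ.≤ n × α ∈ I²ʳ n

infixr 8 _◃ₛ_
infixl 6 _+ₛ_

_◃ₛ_ : Sign → Pred ℝ 0ℓ → Pred ℝ 0ℓ
Sign.+ ◃ₛ P = P
Sign.- ◃ₛ P = λ β → ∃[ α ] α ∈ P × β ≈ - α

_+ₛ_ : Pred ℝ 0ℓ → ℤ → Pred ℝ 0ℓ
P +ₛ n = λ β → ∃[ α ] α ∈ P × β ≈ α + fromℤ n

private
  variable
    ℓ : Level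

-- Closure under inverses is stated relationally: x * y ≈ 1ℝ says that
-- x is nonzero and y is its inverse.
record IsSubfield (K : Pred ℝ ℓ) : Set ℓ where
  field
    resp     : ∀ {x y} → x ≈ y → x ∈ K → y ∈ K
    0-closed : 0ℝ ∈ K
    1-closed : 1ℝ ∈ K
    +-closed : ∀ {x y} → x ∈ K → y ∈ K → x + y ∈ K
    neg-closed : ∀ {x} → x ∈ K → - x ∈ K
    *-closed : ∀ {x y} → x ∈ K → y ∈ K → x * y ∈ K
    inv-closed : ∀ {x y} → x ∈ K → x * y ≈ 1ℝ → y ∈ K

linComb : ∀ {d} → Vec ℚ d → Vec ℝ d → ℝ
linComb []      []      = 0ℝ
linComb (q ∷ c) (x ∷ v) = fromℚ q * x + linComb c v

record IsℚBasis {d} (K : Pred ℝ ℓ) (v : Vec ℝ d) : Set ℓ where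
  field
    member      : (i : Fin d) → lookup v i ∈ K
    spanning    : ∀ {x} → x ∈ K → Σ[ c ∈ Vec ℚ d ] x ≈ linComb c v
    independent : ∀ c → linComb c v ≈ 0ℝ → c ≡ replicate d 0ℚ

record IsRealQuadraticField (K : Pred ℝ ℓ) : Set ℓ where
  field
    isSubfield : IsSubfield K
    degreeTwo  : Σ[ v ∈ Vec ℝ 2 ] IsℚBasis K v

-- The smallest subfield of ℝ containing α.
data ℚ⟮_⟯ (α : ℝ) : Pred ℝ 0ℓ where
  gen  : α ∈ ℚ⟮ α ⟯
  rat  : ∀ q → fromℚ q ∈ ℚ⟮ α ⟯
  resp : ∀ {x y} → x ≈ y → x ∈ ℚ⟮ α ⟯ → y ∈ ℚ⟮ α ⟯
  add  : ∀ {x y} → x ∈ ℚ⟮ α ⟯ → y ∈ ℚ⟮ α ⟯ → x + y ∈ ℚ⟮ α ⟯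
  neg  : ∀ {x} → x ∈ ℚ⟮ α ⟯ → - x ∈ ℚ⟮ α ⟯
  mul  : ∀ {x y} → x ∈ ℚ⟮ α ⟯ → y ∈ ℚ⟮ α ⟯ → x * y ∈ ℚ⟮ α ⟯
  inv  : ∀ {x y} → x ∈ ℚ⟮ α ⟯ → x * y ≈ 1ℝ → y ∈ ℚ⟮ α ⟯

IsPrimitiveElement : Pred ℝ ℓ → ℝ → Set ℓ
IsPrimitiveElement K α = K ≐ ℚ⟮ α ⟯

module Submission where

-- A quadratic integer β is irrational, so it lies strictly between consecutive integers k
-- and k + 1. Let f = X² + nX + c be the minimal polynomial of α = β - k ∈ (0, 1), and recall
-- c = f(0) ≠ 0. If c < 0, then f(1) > 0 by convexity, so -n ≤ c ≤ -1 and α ∈ S. If c > 0,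
-- then f(1) < 0, because f(1) ≥ 0 and f(0) ≥ 1 would make f positive on (0, 1); then the
-- minimal polynomial f(1 - X) of 1 - α has a negative constant term and 1 - α ∈ S.
-- Distinct translates are disjoint: with equal signs because S ⊂ (0, 1); with opposite
-- signs because α = 1 - γ for α, γ ∈ S would give α two monic equations whose linear
-- coefficients are n ≥ 1 and -(2 + n′) < 0.
--
-- That β satisfies a monic quadratic equation over ℤ, not only over ℚ, follows without
-- Gauss's lemma: since β is an algebraic integer, all powers of β and of β - 1 lie in a
-- lattice d⁻¹(ℤ + ℤβ), so the powers of their norms have a common denominator, and a
-- rational number whose powers have a common denominator is an integer.
--
-- Constructively, comparing β with a rational q uses that f(q) ≠ 0 keeps β away from q.

open import Defs
open import Data.Empty using (⊥-elim)
open import Data.Fin using (zero; suc)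
open import Data.Integer as ℤ using (ℤ; +_; -[1+_]; 0ℤ; 1ℤ; -1ℤ)
import Data.Integer.DivMod as ℤ
import Data.Integer.Properties as ℤ
open import Data.Nat as ℕ using (ℕ; zero; suc; _⊔_)
import Data.Nat.Coprimality as Coprimality
import Data.Nat.Properties as ℕ
open import Data.Product using (∃-syntax; _×_; _,_; proj₁; proj₂)
open import Data.Rational as ℚ using (ℚ; mkℚ; 0ℚ; 1ℚ; ½; ∣_∣; toℚᵘ; ↥_)
import Data.Rational.Properties as ℚ
open import Data.Rational.Solver using (module +-*-Solver)
import Data.Rational.Unnormalised as ℚᵘ
import Data.Rational.Unnormalised.Properties as ℚᵘ
open import Data.Sign as Sign using (Sign)
open import Data.Sum as Sum using (_⊎_; inj₁; inj₂)
open import Data.Vec using (Vec; []; _∷_; lookup; map)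
open import Level using (Level)
open import Relation.Binary.Definitions using (tri<; tri≈; tri>)
open import Relation.Binary.PropositionalEquality
  using (_≡_; _≢_; refl; sym; trans; cong; cong₂; subst; subst₂; module ≡-Reasoning)
open import Relation.Nullary using (¬_; Dec; yes; no)
open import Relation.Unary using (Pred; _∈_; _≐_; _⊥_; ⋃)
open +-*-Solver using (solve; _:+_; _:*_; :-_; _:-_; con; _:=_)

-- Order, absolute value and reciprocals in ℚ.

p<q⇒0<q-p : ∀ {p q} → p ℚ.< q → 0ℚ ℚ.< q ℚ.- p
p<q⇒0<q-p {p} {q} p<q = subst (ℚ._< q ℚ.- p) (ℚ.+-inverseʳ p) (ℚ.+-monoˡ-< (ℚ.- p) p<q)

p≤q⇒0≤q-p : ∀ {p q} → p ℚ.≤ q → 0ℚ ℚ.≤ q ℚ.- p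
p≤q⇒0≤q-p {p} {q} p≤q = subst (ℚ._≤ q ℚ.- p) (ℚ.+-inverseʳ p) (ℚ.+-monoˡ-≤ (ℚ.- p) p≤q)

-- With `d` and the equation as separate arguments, an inequality is proved by writing the
-- difference as a visibly positive expression and leaving the identity to the solver.
0<q-p⇒p<q : ∀ {p q d} → 0ℚ ℚ.< d → q ℚ.- p ≡ d → p ℚ.< q
0<q-p⇒p<q {p} {q} {d} 0<d eq =
  subst₂ ℚ._<_ (ℚ.+-identityˡ p)
    (trans (cong (ℚ._+ p) (sym eq)) (solve 2 (λ p q → (q :- p) :+ p := q) refl p q))
    (ℚ.+-monoˡ-< p 0<d)

*-positive : ∀ {p q} → 0ℚ ℚ.< p → 0ℚ ℚ.< q → 0ℚ ℚ.< p ℚ.* q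
*-positive {p} {q} 0<p 0<q =
  ℚ.positive⁻¹ (p ℚ.* q) {{ℚ.pos*pos⇒pos p {{ℚ.positive 0<p}} q {{ℚ.positive 0<q}}}}

*-nonNegative : ∀ {p q} → 0ℚ ℚ.≤ p → 0ℚ ℚ.≤ q → 0ℚ ℚ.≤ p ℚ.* q
*-nonNegative {p} {q} 0≤p 0≤q =
  ℚ.nonNegative⁻¹ (p ℚ.* q)
    {{ℚ.nonNeg*nonNeg⇒nonNeg p {{ℚ.nonNegative 0≤p}} q {{ℚ.nonNegative 0≤q}}}}

0≤p∧p≢0⇒0<p : ∀ {p} → 0ℚ ℚ.≤ p → p ≢ 0ℚ → 0ℚ ℚ.< p
0≤p∧p≢0⇒0<p 0≤p p≢0 = ℚ.≰⇒> λ p≤0 → p≢0 (ℚ.≤-antisym p≤0 0≤p)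

p≤∣p∣ : ∀ p → p ℚ.≤ ∣ p ∣
p≤∣p∣ p with ℚ.≤-total 0ℚ p
... | inj₁ 0≤p = ℚ.≤-reflexive (sym (ℚ.0≤p⇒∣p∣≡p 0≤p))
... | inj₂ p≤0 = ℚ.≤-trans p≤0 (ℚ.0≤∣p∣ p)

∣p∣<q⇒p<q : ∀ {p q} → ∣ p ∣ ℚ.< q → p ℚ.< q
∣p∣<q⇒p<q {p} = ℚ.≤-<-trans (p≤∣p∣ p)

∣p∣<q⇒-p<q : ∀ {p q} → ∣ p ∣ ℚ.< q → ℚ.- p ℚ.< q
∣p∣<q⇒-p<q {p} {q} h = ∣p∣<q⇒p<q (subst (ℚ._< q) (sym (ℚ.∣-p∣≡∣p∣ p)) h)

p<q∧-p<q⇒∣p∣<q : ∀ {p q} → p ℚ.< q → ℚ.- p ℚ.< q → ∣ p ∣ ℚ.< q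
p<q∧-p<q⇒∣p∣<q {p} {q} h h′ with ℚ.∣p∣≡p∨∣p∣≡-p p
... | inj₁ eq = subst (ℚ._< q) (sym eq) h
... | inj₂ eq = subst (ℚ._< q) (sym eq) h′

reciprocal : ∀ {p} → p ≢ 0ℚ → ∃[ r ] p ℚ.* r ≡ 1ℚ
reciprocal {p} p≢0 = (ℚ.1/ p) {{ℚ.≢-nonZero p≢0}} , ℚ.*-inverseʳ p {{ℚ.≢-nonZero p≢0}}

p-q≡0⇒p≡q : ∀ {p q} → p ℚ.- q ≡ 0ℚ → p ≡ q
p-q≡0⇒p≡q {p} {q} eq = begin
  p                ≡⟨ solve 2 (λ p q → p := (p :- q) :+ q) refl p q ⟩
  p ℚ.- q ℚ.+ q    ≡⟨ cong (ℚ._+ q) eq ⟩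
  0ℚ ℚ.+ q         ≡⟨ ℚ.+-identityˡ q ⟩
  q                ∎
  where open ≡-Reasoning

-- Integers among the rationals

coprime-to-1 : ∀ n → Coprimality.Coprime n 1
coprime-to-1 n = Coprimality.sym (Coprimality.1-coprimeTo n)

-- The quotient `k / 1` is normalised by a gcd and is stuck for a variable `k`; the explicit
-- fraction computes.
ℤ→ℚ-mkℚ : ∀ k → ℤ→ℚ k ≡ mkℚ k 0 (coprime-to-1 ℤ.∣ k ∣)
ℤ→ℚ-mkℚ k = ℚ.↥p/↧p≡p (mkℚ k 0 (coprime-to-1 ℤ.∣ k ∣))

↥-ℤ→ℚ : ∀ k → ↥ (ℤ→ℚ k) ≡ k
↥-ℤ→ℚ k = cong ↥_ (ℤ→ℚ-mkℚ k)

ℤ→ℚ-homo-+ : ∀ j k → ℤ→ℚ (j ℤ.+ k) ≡ ℤ→ℚ j ℚ.+ ℤ→ℚ k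
ℤ→ℚ-homo-+ j k = begin
  ℤ→ℚ (j ℤ.+ k)
    -- The sum of the two explicit fractions computes to a quotient with numerator `j * 1 + k * 1`
    -- and denominator 1.
    ≡⟨ cong₂ (λ j k → ℤ→ℚ (j ℤ.+ k)) (ℤ.*-identityʳ j) (ℤ.*-identityʳ k) ⟨
  mkℚ j 0 (coprime-to-1 ℤ.∣ j ∣) ℚ.+ mkℚ k 0 (coprime-to-1 ℤ.∣ k ∣)
    ≡⟨ cong₂ ℚ._+_ (ℤ→ℚ-mkℚ j) (ℤ→ℚ-mkℚ k) ⟨
  ℤ→ℚ j ℚ.+ ℤ→ℚ k
    ∎
  where open ≡-Reasoning

ℤ→ℚ-homo-* : ∀ j k → ℤ→ℚ (j ℤ.* k) ≡ ℤ→ℚ j ℚ.* ℤ→ℚ k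
ℤ→ℚ-homo-* j k = sym (cong₂ ℚ._*_ (ℤ→ℚ-mkℚ j) (ℤ→ℚ-mkℚ k))

ℤ→ℚ-homo‿- : ∀ k → ℤ→ℚ (ℤ.- k) ≡ ℚ.- ℤ→ℚ k
ℤ→ℚ-homo‿- k = begin
  ℤ→ℚ (ℤ.- k)
    ≡⟨ solve 2 (λ x y → x := (x :+ y) :- y) refl (ℤ→ℚ (ℤ.- k)) (ℤ→ℚ k) ⟩
  ℤ→ℚ (ℤ.- k) ℚ.+ ℤ→ℚ k ℚ.- ℤ→ℚ k
    ≡⟨ cong (ℚ._- ℤ→ℚ k) (ℤ→ℚ-homo-+ (ℤ.- k) k) ⟨
  ℤ→ℚ (ℤ.- k ℤ.+ k) ℚ.- ℤ→ℚ k
    ≡⟨ cong (λ j → ℤ→ℚ j ℚ.- ℤ→ℚ k) (ℤ.+-inverseˡ k) ⟩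
  0ℚ ℚ.- ℤ→ℚ k
    ≡⟨ ℚ.+-identityˡ _ ⟩
  ℚ.- ℤ→ℚ k ∎
  where open ≡-Reasoning

ℤ→ℚ-injective : ∀ {j k} → ℤ→ℚ j ≡ ℤ→ℚ k → j ≡ k
ℤ→ℚ-injective {j} {k} eq = trans (sym (↥-ℤ→ℚ j)) (trans (cong ↥_ eq) (↥-ℤ→ℚ k))

ℤ→ℚ-mono-≤ : ∀ {j k} → j ℤ.≤ k → ℤ→ℚ j ℚ.≤ ℤ→ℚ k
ℤ→ℚ-mono-≤ {j} {k} j≤k = subst₂ ℚ._≤_ (sym (ℤ→ℚ-mkℚ j)) (sym (ℤ→ℚ-mkℚ k))
  (ℚ.*≤* (subst₂ ℤ._≤_ (sym (ℤ.*-identityʳ j)) (sym (ℤ.*-identityʳ k)) j≤k))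

ℤ→ℚ-cancel-< : ∀ {j k} → ℤ→ℚ j ℚ.< ℤ→ℚ k → j ℤ.< k
ℤ→ℚ-cancel-< {j} {k} j<k =
  ℤ.≰⇒> λ k≤j → ℚ.<-irrefl refl (ℚ.<-≤-trans j<k (ℤ→ℚ-mono-≤ k≤j))

-- Division with remainder of the numerator by the denominator: `k` is the quotient, and the upper
-- bound holds because the remainder is less than the denominator.
⌊⌋-bounds : ∀ q → ∃[ k ] ℤ→ℚ k ℚ.≤ q × q ℚ.< 1ℚ ℚ.+ ℤ→ℚ k
⌊⌋-bounds q@(mkℚ n d-1 _) =
  k ,
  subst (ℚ._≤ q) (sym (ℤ→ℚ-mkℚ k))
    (ℚ.*≤* (subst (k ℤ.* d ℤ.≤_) (sym (ℤ.*-identityʳ n)) (ℤ.[n/ℕd]*d≤n n (suc d-1)))) ,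
  subst (q ℚ.<_) (trans (sym (ℤ→ℚ-mkℚ (1ℤ ℤ.+ k))) (ℤ→ℚ-homo-+ 1ℤ k))
    (ℚ.*<* (subst₂ ℤ._<_ upper₁ upper₂
      (ℤ.+-monoˡ-< (k ℤ.* d) (ℤ.+<+ (ℤ.n%ℕd<d n (suc d-1))))))
  where
  d k : ℤ
  d = + suc d-1
  k = n ℤ./ℕ suc d-1
  upper₁ : + (n ℤ.%ℕ suc d-1) ℤ.+ k ℤ.* d ≡ n ℤ.* 1ℤ
  upper₁ = trans (sym (ℤ.a≡a%ℕn+[a/ℕn]*n n (suc d-1))) (sym (ℤ.*-identityʳ n))
  upper₂ : d ℤ.+ k ℤ.* d ≡ (1ℤ ℤ.+ k) ℤ.* d
  upper₂ = sym (ℤ.suc-* k d)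

IsInt : ℚ → Set
IsInt q = ∃[ k ] q ≡ ℤ→ℚ k

int : ∀ k → IsInt (ℤ→ℚ k)
int k = k , refl

int-+ : ∀ {p q} → IsInt p → IsInt q → IsInt (p ℚ.+ q)
int-+ (j , refl) (k , refl) = j ℤ.+ k , sym (ℤ→ℚ-homo-+ j k)

int-* : ∀ {p q} → IsInt p → IsInt q → IsInt (p ℚ.* q)
int-* (j , refl) (k , refl) = j ℤ.* k , sym (ℤ→ℚ-homo-* j k)

int-neg : ∀ {p} → IsInt p → IsInt (ℚ.- p)
int-neg (k , refl) = ℤ.- k , sym (ℤ→ℚ-homo‿- k)

int-resp : ∀ {p q} → p ≡ q → IsInt p → IsInt q
int-resp = subst IsInt

-- The product of the two denominators serves. It stays a rational with a proof of `IsInt`, so that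
-- it multiplies other rationals without casts.
common-denominator : ∀ p q → ∃[ d ] 0ℚ ℚ.< d × IsInt d × IsInt (d ℚ.* p) × IsInt (d ℚ.* q)
common-denominator p q with denominator p | denominator q
  where
  denominator : ∀ p → ∃[ d ] 0ℚ ℚ.< d × IsInt d × IsInt (d ℚ.* p)
  denominator p@(mkℚ n d-1 c) = ℤ→ℚ d , 0<d , int d , n ,
    ℚ.toℚᵘ-injective (begin
      toℚᵘ (ℤ→ℚ d ℚ.* p)           ≈⟨ ℚ.toℚᵘ-homo-* (ℤ→ℚ d) p ⟩
      toℚᵘ (ℤ→ℚ d) ℚᵘ.* toℚᵘ p     ≈⟨ ℚᵘ.*-congʳ (ℚ.toℚᵘ-fromℚᵘ (ℚᵘ.mkℚᵘ d 0)) ⟩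
      ℚᵘ.mkℚᵘ d 0 ℚᵘ.* toℚᵘ p      ≈⟨ ℚᵘ.*≡* cross ⟩
      ℚᵘ.mkℚᵘ n 0                  ≈⟨ ℚ.toℚᵘ-fromℚᵘ (ℚᵘ.mkℚᵘ n 0) ⟨
      toℚᵘ (ℤ→ℚ n)                 ∎)
    where
    open ℚᵘ.≃-Reasoning
    d : ℤ
    d = + suc d-1
    0<d : 0ℚ ℚ.< ℤ→ℚ d
    0<d = subst (0ℚ ℚ.<_) (sym (ℤ→ℚ-mkℚ d)) (ℚ.positive⁻¹ (mkℚ d 0 (coprime-to-1 (suc d-1))))
    cross : d ℤ.* n ℤ.* 1ℤ ≡ n ℤ.* + (1 ℕ.* suc d-1)
    cross = trans (ℤ.*-identityʳ (d ℤ.* n))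
      (trans (ℤ.*-comm d n) (cong (λ e → n ℤ.* + e) (sym (ℕ.*-identityˡ (suc d-1)))))
... | d , 0<d , d-int , dp-int | e , 0<e , e-int , eq-int =
  d ℚ.* e , *-positive 0<d 0<e , int-* d-int e-int ,
  int-resp (solve 3 (λ d e p → e :* (d :* p) := d :* e :* p) refl d e p) (int-* e-int dp-int) ,
  int-resp (sym (ℚ.*-assoc d e q)) (int-* d-int eq-int)

-- Descent: multiplying the sequence by the fractional part of q keeps it integral and
-- makes its first term smaller.
geometric-integral : ∀ {q} (s : ℕ → ℚ) → 0ℚ ℚ.< s 0 → (∀ k → IsInt (s k)) →
  (∀ k → s (suc k) ≡ q ℚ.* s k) → IsInt q
geometric-integral {q} s 0<s₀ s-int s-step with s-int 0
... | b , s₀≡b = descend ℤ.∣ b ∣ s 0<s₀ s-int s-step (b , s₀≡b , ℤ.≤-reflexive (sym (ℤ.0≤i⇒+∣i∣≡i 0≤b)))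
  where
  0≤b : 0ℤ ℤ.≤ b
  0≤b = ℤ.<⇒≤ (ℤ→ℚ-cancel-< (subst (0ℚ ℚ.<_) s₀≡b 0<s₀))
  descend : ∀ n (s : ℕ → ℚ) → 0ℚ ℚ.< s 0 → (∀ k → IsInt (s k)) →
    (∀ k → s (suc k) ≡ q ℚ.* s k) → ∃[ b ] s 0 ≡ ℤ→ℚ b × b ℤ.≤ + n → IsInt q
  descend zero s 0<s₀ _ _ (b , s₀≡b , b≤0) = ⊥-elim (ℚ.<-irrefl refl
    (ℚ.<-≤-trans (subst (0ℚ ℚ.<_) s₀≡b 0<s₀) (ℤ→ℚ-mono-≤ b≤0)))
  descend (suc n) s 0<s₀ s-int s-step (b , s₀≡b , b≤1+n) with ⌊⌋-bounds q
  ... | k , k≤q , q<1+k with q ℚ.- ℤ→ℚ k ℚ.≟ 0ℚ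
  ... | yes f≡0 = k , p-q≡0⇒p≡q f≡0
  ... | no f≢0 = descend n (λ i → f ℚ.* s i) (*-positive 0<f 0<s₀) fs-int
    (λ i → trans (cong (f ℚ.*_) (s-step i))
      (solve 3 (λ f q x → f :* (q :* x) := q :* (f :* x)) refl f q (s i)))
    (a , fs₀≡a , ℤ.i<j⇒i≤pred[j] (ℤ.<-≤-trans a<b b≤1+n))
    where
    f : ℚ
    f = q ℚ.- ℤ→ℚ k
    0<f : 0ℚ ℚ.< f
    0<f = 0≤p∧p≢0⇒0<p (p≤q⇒0≤q-p k≤q) f≢0
    -- The recursion turns `f * s i` into `s (suc i) - k * s i`, a difference of integers.
    fs-int : ∀ i → IsInt (f ℚ.* s i)
    fs-int i = int-resp
      (trans (cong (ℚ._- ℤ→ℚ k ℚ.* s i) (s-step i))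
        (solve 3 (λ q k x → q :* x :- k :* x := (q :- k) :* x) refl q (ℤ→ℚ k) (s i)))
      (int-+ (s-int (suc i)) (int-neg (int-* (int k) (s-int i))))
    a : ℤ
    a = proj₁ (fs-int 0)
    fs₀≡a : f ℚ.* s 0 ≡ ℤ→ℚ a
    fs₀≡a = proj₂ (fs-int 0)
    a<b : a ℤ.< b
    a<b = ℤ→ℚ-cancel-< (subst₂ ℚ._<_ fs₀≡a s₀≡b
      (0<q-p⇒p<q (*-positive (p<q⇒0<q-p q<1+k) 0<s₀)
        (solve 3 (λ q k x → x :- (q :- k) :* x := ((con 1ℚ :+ k) :- q) :* x) refl q (ℤ→ℚ k) (s 0))))

-- Cauchy reals

Eventually : (ℕ → Set) → Set
Eventually P = ∃[ N ] (∀ n → N ℕ.≤ n → P n)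

eventually-map : ∀ {P Q : ℕ → Set} → (∀ n → P n → Q n) → Eventually P → Eventually Q
eventually-map f (N , p) = N , λ n N≤n → f n (p n N≤n)

eventually-zip : ∀ {P Q : ℕ → Set} → Eventually P → Eventually Q → Eventually (λ n → P n × Q n)
eventually-zip (M , p) (N , q) = M ⊔ N , λ n le →
  p n (ℕ.m⊔n≤o⇒m≤o M N le) , q n (ℕ.m⊔n≤o⇒n≤o M N le)

eventually-witness : ∀ {P : ℕ → Set} → Eventually P → ∃[ n ] P n
eventually-witness (N , p) = N , p N ℕ.≤-refl

≈-trans : ∀ {x y z} → x ≈ y → y ≈ z → x ≈ z
≈-trans {x} {y} {z} x≈y y≈z = mk≈ λ ε 0<ε →
  let δ , 0<δ , δ+δ≡ε = halve 0<ε in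
  eventually-map
    (λ n (p , q) → subst₂ ℚ._<_
      (cong ∣_∣ (solve 3 (λ x y z → (x :+ y) :- (y :+ z) := x :- z) refl (seq x n) (seq y n) (seq z n)))
      δ+δ≡ε
      (+-close (seq x n) (seq y n) (seq y n) (seq z n) p q))
    (eventually-zip (close x≈y δ 0<δ) (close y≈z δ 0<δ))

-- Congruence and ring reasoning modulo _≈_ in one step: it leaves an identity in ℚ.
≈-combine : ∀ {x y z w} (c : ℝ) → x ≈ y →
  (∀ n → seq z n ℚ.- seq w n ≡ seq c n ℚ.* (seq x n ℚ.- seq y n)) → z ≈ w
≈-combine {x} {y} c x≈y eq = mk≈ λ ε 0<ε →
  let C , 0<C , bounded = eventually-bounded (cauchy c)
      δ , 0<δ , Cδ≡ε    = divide 0<C 0<ε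
  in eventually-map
    (λ n (p , q) → subst₂ ℚ._<_ (cong ∣_∣ (sym (eq n))) Cδ≡ε
      (*-small (seq c n) (seq x n ℚ.- seq y n) 0<C p q))
    (eventually-zip bounded (close x≈y δ 0<δ))

-- The intermediate real `z - c * (x - y)` absorbs the first hypothesis and leaves the case of a
-- single one.
≈-combine₂ : ∀ {x y x′ y′ z w} (c d : ℝ) → x ≈ y → x′ ≈ y′ →
  (∀ n → seq z n ℚ.- seq w n ≡
    seq c n ℚ.* (seq x n ℚ.- seq y n) ℚ.+ seq d n ℚ.* (seq x′ n ℚ.- seq y′ n)) →
  z ≈ w
≈-combine₂ {x} {y} {x′} {y′} {z} {w} c d x≈y x′≈y′ eq = ≈-trans
  (≈-combine {z = z} {w = z + - (c * (x + - y))} c x≈y λ n →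
    solve 4 (λ z c x y → z :- (z :- c :* (x :- y)) := c :* (x :- y)) refl
      (seq z n) (seq c n) (seq x n) (seq y n))
  (≈-combine d x′≈y′ λ n → begin
    seq z n ℚ.- seq c n ℚ.* (seq x n ℚ.- seq y n) ℚ.- seq w n
      ≡⟨ solve 3 (λ z t w → z :- t :- w := (z :- w) :- t) refl
           (seq z n) (seq c n ℚ.* (seq x n ℚ.- seq y n)) (seq w n) ⟩
    seq z n ℚ.- seq w n ℚ.- seq c n ℚ.* (seq x n ℚ.- seq y n)
      ≡⟨ cong (ℚ._- seq c n ℚ.* (seq x n ℚ.- seq y n)) (eq n) ⟩
    seq c n ℚ.* (seq x n ℚ.- seq y n) ℚ.+ seq d n ℚ.* (seq x′ n ℚ.- seq y′ n)
      ℚ.- seq c n ℚ.* (seq x n ℚ.- seq y n)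
      ≡⟨ solve 2 (λ s t → s :+ t :- s := t) refl
           (seq c n ℚ.* (seq x n ℚ.- seq y n)) (seq d n ℚ.* (seq x′ n ℚ.- seq y′ n)) ⟩
    seq d n ℚ.* (seq x′ n ℚ.- seq y′ n) ∎)
  where open ≡-Reasoning

≈-pointwise : ∀ {x y} → (∀ n → seq x n ≡ seq y n) → x ≈ y
≈-pointwise {x} {y} eq = mk≈ λ ε 0<ε → 0 , λ n _ →
  subst (λ q → ∣ q ∣ ℚ.< ε)
    (sym (trans (cong (ℚ._- seq y n) (eq n)) (ℚ.+-inverseʳ (seq y n)))) 0<ε

≈-refl : ∀ {x} → x ≈ x
≈-refl = ≈-pointwise λ _ → refl

≈-sym : ∀ {x y} → x ≈ y → y ≈ x
≈-sym {x} {y} x≈y = ≈-combine (- 1ℝ) x≈y λ n →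
  solve 2 (λ x y → y :- x := (:- con 1ℚ) :* (x :- y)) refl (seq x n) (seq y n)

fromℚ-injective : ∀ {p q} → fromℚ p ≈ fromℚ q → p ≡ q
fromℚ-injective {p} {q} p≈q with ∣ p ℚ.- q ∣ ℚ.≟ 0ℚ
... | yes eq = p-q≡0⇒p≡q (ℚ.∣p∣≡0⇒p≡0 (p ℚ.- q) eq)
-- A positive distance between `p` and `q` could serve as its own ε.
... | no neq = ⊥-elim (ℚ.<-irrefl refl (proj₂ (eventually-witness
  (close p≈q ∣ p ℚ.- q ∣ (0≤p∧p≢0⇒0<p (ℚ.0≤∣p∣ (p ℚ.- q)) neq)))))

<-asym : ∀ {x y} → x < y → ¬ (y < x)
<-asym {x} {y} (ε , 0<ε , x<y) (δ , 0<δ , y<x) with eventually-witness (eventually-zip x<y y<x)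
... | n , p , q = ℚ.<-asym
  (ℚ.<-trans (0<q-p⇒p<q 0<ε (solve 2 (λ x ε → (x :+ ε) :- x := ε) refl (seq x n) ε)) p)
  (ℚ.<-trans (0<q-p⇒p<q 0<δ (solve 2 (λ x ε → (x :+ ε) :- x := ε) refl (seq y n) δ)) q)

-- A strict inequality depends only on the difference of its sides; half of the gap pays for the
-- error in the approximate equality of differences.
<-combine : ∀ {x y x′ y′} → x < y → y′ + - x′ ≈ y + - x → x′ < y′
<-combine {x} {y} {x′} {y′} (ε , 0<ε , x<y) eq with halve 0<ε
... | δ , 0<δ , refl = δ , 0<δ , eventually-map
  (λ n (p , q) → 0<q-p⇒p<q (+-positive (p<q⇒0<q-p p) (p<q⇒0<q-p (∣p∣<q⇒-p<q q)))
    (solve 5 (λ x y x′ y′ δ → y′ :- (x′ :+ δ) :=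
        (y :- (x :+ (δ :+ δ))) :+ (δ :- (:- ((y′ :- x′) :- (y :- x))))) refl
      (seq x n) (seq y n) (seq x′ n) (seq y′ n) δ))
  (eventually-zip x<y (close eq δ 0<δ))

-- A constructive substitute for trichotomy, decided on one late term. With ε = 4η and a tail within
-- η of that term, a term beyond 2η in absolute value fixes the sign with gap η; otherwise the tail
-- stays below 3η.
sign-or-small : ∀ x {ε} → 0ℚ ℚ.< ε →
  (0ℝ < x ⊎ x < 0ℝ) ⊎ Eventually (λ n → ∣ seq x n ∣ ℚ.< ε)
sign-or-small x {ε} 0<ε with halve 0<ε
... | δ , 0<δ , refl with halve 0<δ
... | η , 0<η , refl with cauchy x η 0<η
... | N , near with δ ℚ.<? seq x N | δ ℚ.<? (ℚ.- seq x N)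
... | yes p | _ = inj₁ (inj₁ (η , 0<η , N , λ n N≤n →
  0<q-p⇒p<q
    (+-positive (p<q⇒0<q-p p) (p<q⇒0<q-p (∣p∣<q⇒p<q (near N n ℕ.≤-refl N≤n))))
    (solve 3 (λ x y η → y :- (con 0ℚ :+ η) := (x :- (η :+ η)) :+ (η :- (x :- y))) refl
      (seq x N) (seq x n) η)))
... | no _ | yes p = inj₁ (inj₂ (η , 0<η , N , λ n N≤n →
  0<q-p⇒p<q
    (+-positive (p<q⇒0<q-p p) (p<q⇒0<q-p (∣p∣<q⇒-p<q (near N n ℕ.≤-refl N≤n))))
    (solve 3 (λ x y η → con 0ℚ :- (y :+ η) := ((:- x) :- (η :+ η)) :+ (η :- (:- (x :- y)))) refl
      (seq x N) (seq x n) η)))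
... | no p | no q = inj₂ (N , λ n N≤n →
  p<q∧-p<q⇒∣p∣<q
    (0<q-p⇒p<q
      (ℚ.+-mono-<-≤
        (+-positive 0<η (p<q⇒0<q-p (∣p∣<q⇒-p<q (near N n ℕ.≤-refl N≤n))))
        (p≤q⇒0≤q-p (ℚ.≮⇒≥ p)))
      (solve 3 (λ x y η → (η :+ η :+ (η :+ η)) :- y :=
        (η :+ (η :- (:- (x :- y)))) :+ ((η :+ η) :- x)) refl (seq x N) (seq x n) η))
    (0<q-p⇒p<q
      (ℚ.+-mono-<-≤
        (+-positive 0<η (p<q⇒0<q-p (∣p∣<q⇒p<q (near N n ℕ.≤-refl N≤n))))
        (p≤q⇒0≤q-p (ℚ.≮⇒≥ q)))
      (solve 3 (λ x y η → (η :+ η :+ (η :+ η)) :- (:- y) :=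
        (η :+ (η :- (x :- y))) :+ ((η :+ η) :- (:- x))) refl (seq x N) (seq x n) η)))

-- If `∣ y ∣ < B` and `∣ x ∣ < 1 / (2 B)` eventually, the product stays below ½ and cannot approach
-- 1; this rules out the small case.
invertible⇒signed : ∀ {x y} → x * y ≈ 1ℝ → 0ℝ < x ⊎ x < 0ℝ
invertible⇒signed {x} {y} xy≈1 with eventually-bounded (cauchy y)
... | B , 0<B , bounded with divide 0<B (ℚ.positive⁻¹ ½)
... | δ , 0<δ , Bδ≡½ with sign-or-small x 0<δ
... | inj₁ signed = signed
... | inj₂ small with eventually-witness
                       (eventually-zip (eventually-zip bounded small) (close xy≈1 ½ (ℚ.positive⁻¹ ½)))
... | n , (∣y∣<B , ∣x∣<δ) , near = ⊥-elim (ℚ.<-irrefl 1≡ (ℚ.≤-<-trans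
  (p≤∣p∣ (y′ ℚ.* x′ ℚ.- (x′ ℚ.* y′ ℚ.- 1ℚ)))
  (ℚ.≤-<-trans (ℚ.∣p-q∣≤∣p∣+∣q∣ (y′ ℚ.* x′) (x′ ℚ.* y′ ℚ.- 1ℚ))
    (ℚ.+-mono-< (subst (∣ y′ ℚ.* x′ ∣ ℚ.<_) Bδ≡½ (*-small y′ x′ 0<B ∣y∣<B ∣x∣<δ)) near))))
  where
  x′ y′ : ℚ
  x′ = seq x n
  y′ = seq y n
  1≡ : y′ ℚ.* x′ ℚ.- (x′ ℚ.* y′ ℚ.- 1ℚ) ≡ 1ℚ
  1≡ = solve 2 (λ x y → y :* x :- (x :* y :- con 1ℚ) := con 1ℚ) refl x′ y′

nonzero-product⇒signed : ∀ {x y p} → p ≢ 0ℚ → x * y ≈ fromℚ p → 0ℝ < x ⊎ x < 0ℝ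
nonzero-product⇒signed {x} {y} {p} p≢0 xy≈p with reciprocal p≢0
... | r , pr≡1 = invertible⇒signed {x} {y * fromℚ r} (≈-combine (fromℚ r) xy≈p λ n → begin
  seq x n ℚ.* (seq y n ℚ.* r) ℚ.- 1ℚ           ≡⟨ cong (λ e → seq x n ℚ.* (seq y n ℚ.* r) ℚ.- e) pr≡1 ⟨
  seq x n ℚ.* (seq y n ℚ.* r) ℚ.- p ℚ.* r      ≡⟨ solve 4 (λ x y r p → x :* (y :* r) :- p :* r := r :* (x :* y :- p)) refl (seq x n) (seq y n) r p ⟩
  r ℚ.* (seq x n ℚ.* seq y n ℚ.- p)            ∎)
  where open ≡-Reasoning

-- If `x` is eventually above ε, then `ε * ∣ y ∣` is at most `∣ x * y ∣`, so tolerance `ε * δ` for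
-- the product gives δ for `y`. Negation reduces negative `x` to this case.
signed-cancel : ∀ {x y} → 0ℝ < x ⊎ x < 0ℝ → x * y ≈ 0ℝ → y ≈ 0ℝ
signed-cancel {x} {y} (inj₂ x<0) xy≈0 =
  signed-cancel {x = - x}
    (inj₁ (<-combine {x} {0ℝ} {0ℝ} { - x} x<0 (≈-pointwise λ n →
      solve 1 (λ x → (:- x) :- con 0ℚ := con 0ℚ :- x) refl (seq x n))))
    (≈-combine (- 1ℝ) xy≈0 λ n →
      solve 2 (λ x y → (:- x) :* y :- con 0ℚ := (:- con 1ℚ) :* (x :* y :- con 0ℚ)) refl
        (seq x n) (seq y n))
signed-cancel {x} {y} (inj₁ (ε , 0<ε , 0<x)) xy≈0 = mk≈ λ δ 0<δ → eventually-map
  (λ n (ε<x , small) →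
    let ε≤∣x∣ = ℚ.≤-trans (ℚ.<⇒≤ (subst (ℚ._< seq x n) (ℚ.+-identityˡ ε) ε<x)) (p≤∣p∣ (seq x n))
    in ℚ.*-cancelˡ-<-nonNeg ε {{ℚ.nonNegative (ℚ.<⇒≤ 0<ε)}} (begin-strict
      ε ℚ.* ∣ seq y n ℚ.- 0ℚ ∣              ≤⟨ ℚ.*-monoʳ-≤-nonNeg ∣ seq y n ℚ.- 0ℚ ∣ {{ℚ.∣-∣-nonNeg (seq y n ℚ.- 0ℚ)}} ε≤∣x∣ ⟩
      ∣ seq x n ∣ ℚ.* ∣ seq y n ℚ.- 0ℚ ∣    ≡⟨ ℚ.∣p*q∣≡∣p∣*∣q∣ (seq x n) (seq y n ℚ.- 0ℚ) ⟨
      ∣ seq x n ℚ.* (seq y n ℚ.- 0ℚ) ∣      ≡⟨ cong ∣_∣ (solve 2 (λ x y → x :* (y :- con 0ℚ) := x :* y :- con 0ℚ) refl (seq x n) (seq y n)) ⟩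
      ∣ seq x n ℚ.* seq y n ℚ.- 0ℚ ∣        <⟨ small ⟩
      ε ℚ.* δ                               ∎))
  (eventually-zip 0<x (close xy≈0 (ε ℚ.* δ) (*-positive 0<ε 0<δ)))
  where open ℚ.≤-Reasoning

-- For each ε either `y` is small, as wanted, or `y` has a sign; in the latter case it cancels and
-- forces `x ≈ 0ℝ`, contrary to the hypothesis.
integral-domain : ∀ {x y} → x * y ≈ 0ℝ → ¬ (x ≈ 0ℝ) → y ≈ 0ℝ
integral-domain {x} {y} xy≈0 x≉0 = mk≈ λ ε 0<ε → locate ε (sign-or-small y 0<ε)
  where
  locate : ∀ ε → (0ℝ < y ⊎ y < 0ℝ) ⊎ Eventually (λ n → ∣ seq y n ∣ ℚ.< ε) →
    Eventually (λ n → ∣ seq y n ℚ.- 0ℚ ∣ ℚ.< ε)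
  locate ε (inj₂ small) = eventually-map
    (λ n → subst (λ q → ∣ q ∣ ℚ.< ε) (solve 1 (λ y → y := y :- con 0ℚ) refl (seq y n))) small
  locate ε (inj₁ signed) = ⊥-elim (x≉0 (signed-cancel {y} {x} signed
    (≈-combine 1ℝ xy≈0 λ n →
      solve 2 (λ x y → y :* x :- con 0ℚ := con 1ℚ :* (x :* y :- con 0ℚ)) refl (seq x n) (seq y n))))

-- Irrational numbers and their quadratic equations.

Irrational : ℝ → Set
Irrational α = ∀ q → ¬ (α ≈ fromℚ q)

-- For nonzero `v`, α would be the rational `-u / v`, and equality in ℚ is decidable.
irrational-independent : ∀ {α} → Irrational α → ∀ u v →
  fromℚ u + fromℚ v * α ≈ 0ℝ → u ≡ 0ℚ × v ≡ 0ℚ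
irrational-independent {α} irr u v eq with v ℚ.≟ 0ℚ
... | yes refl = fromℚ-injective (≈-trans (≈-pointwise (λ n →
        solve 2 (λ u α → u := u :+ con 0ℚ :* α) refl u (seq α n))) eq) , refl
... | no v≢0 with reciprocal v≢0
... | r , vr≡1 = ⊥-elim (irr (ℚ.- (u ℚ.* r)) (≈-combine (fromℚ r) eq λ n → begin
  seq α n ℚ.- (ℚ.- (u ℚ.* r))                        ≡⟨ solve 3 (λ u r α → α :- (:- (u :* r)) := con 1ℚ :* α :+ u :* r) refl u r (seq α n) ⟩
  1ℚ ℚ.* seq α n ℚ.+ u ℚ.* r                         ≡⟨ cong (λ e → e ℚ.* seq α n ℚ.+ u ℚ.* r) vr≡1 ⟨
  v ℚ.* r ℚ.* seq α n ℚ.+ u ℚ.* r                    ≡⟨ solve 4 (λ u v r α → v :* r :* α :+ u :* r := r :* ((u :+ v :* α) :- con 0ℚ)) refl u v r (seq α n) ⟩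
  r ℚ.* (u ℚ.+ v ℚ.* seq α n ℚ.- 0ℚ)                 ∎))
  where open ≡-Reasoning

IsQuadraticRoot : ℝ → ℚ → ℚ → Set
IsQuadraticRoot α a b = α * α + fromℚ a * α + fromℚ b ≈ 0ℝ

-- (α - q)(α + q + a) is minus the value at q of the polynomial with root α.
irrational-root-separated : ∀ {α a b} → Irrational α → IsQuadraticRoot α a b →
  ∀ q → α < fromℚ q ⊎ fromℚ q < α
irrational-root-separated {α} {a} {b} irr root q = separate (f ℚ.≟ 0ℚ)
  where
  f : ℚ
  f = ℚ.- (q ℚ.* q ℚ.+ a ℚ.* q ℚ.+ b)
  x y : ℝ
  x = α + - fromℚ q
  y = α + fromℚ (q ℚ.+ a)
  xy≈f : x * y ≈ fromℚ f
  xy≈f = ≈-combine 1ℝ root λ n → solve 4 (λ α a b q →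
    (α :- q) :* (α :+ (q :+ a)) :- (:- (q :* q :+ a :* q :+ b)) :=
    con 1ℚ :* ((α :* α :+ a :* α :+ b) :- con 0ℚ)) refl (seq α n) a b q
  separate : Dec (f ≡ 0ℚ) → α < fromℚ q ⊎ fromℚ q < α
  -- If `q` is a root of the polynomial, the other root `-(q + a)` is rational too, and α differs
  -- from `q`, so it would be that one.
  separate (yes f≡0) = ⊥-elim (irr (ℚ.- (q ℚ.+ a)) (≈-combine 1ℝ y≈0 λ n →
    solve 3 (λ α a q → α :- (:- (q :+ a)) := con 1ℚ :* ((α :+ (q :+ a)) :- con 0ℚ)) refl (seq α n) a q))
    where
    y≈0 : y ≈ 0ℝ
    y≈0 = integral-domain (subst (λ f → x * y ≈ fromℚ f) f≡0 xy≈f) λ x≈0 →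
      irr q (≈-combine 1ℝ x≈0 λ n →
        solve 2 (λ α q → α :- q := con 1ℚ :* ((α :- q) :- con 0ℚ)) refl (seq α n) q)
  separate (no f≢0) = Sum.swap (Sum.map
    (λ 0<x → <-combine {0ℝ} {x} {fromℚ q} {α} 0<x (≈-pointwise λ n →
      solve 2 (λ α q → α :- q := (α :- q) :- con 0ℚ) refl (seq α n) q))
    (λ x<0 → <-combine {x} {0ℝ} {α} {fromℚ q} x<0 (≈-pointwise λ n →
      solve 2 (λ α q → q :- α := con 0ℚ :- (α :- q)) refl (seq α n) q))
    (nonzero-product⇒signed {x} {y} f≢0 xy≈f))

-- Integer parts of reals.

integer-bound : ∀ x → ∃[ m ] fromℤ (ℤ.- + m) < x × x < fromℤ (+ m)
integer-bound x with eventually-bounded (cauchy x)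
... | B , 0<B , bounded with ⌊⌋-bounds B
... | k , _ , B<1+k = ℤ.∣ K ∣ ,
  (1ℚ , ℚ.positive⁻¹ 1ℚ , eventually-map
    (λ n ∣x∣<B → subst (λ q → q ℚ.+ 1ℚ ℚ.< seq x n)
      (trans (sym (ℤ→ℚ-homo‿- K)) (cong (λ j → ℤ→ℚ (ℤ.- j)) (sym +∣K∣≡K)))
      (0<q-p⇒p<q (+-positive (p<q⇒0<q-p B<K-1) (p<q⇒0<q-p (∣p∣<q⇒-p<q ∣x∣<B)))
        (solve 3 (λ x B K → x :- ((:- K) :+ con 1ℚ) := ((K :- con 1ℚ) :- B) :+ (B :- (:- x))) refl
          (seq x n) B (ℤ→ℚ K))))
    bounded) ,
  (1ℚ , ℚ.positive⁻¹ 1ℚ , eventually-map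
    (λ n ∣x∣<B → subst (λ j → seq x n ℚ.+ 1ℚ ℚ.< ℤ→ℚ j) (sym +∣K∣≡K)
      (0<q-p⇒p<q (+-positive (p<q⇒0<q-p B<K-1) (p<q⇒0<q-p (∣p∣<q⇒p<q ∣x∣<B)))
        (solve 3 (λ x B K → K :- (x :+ con 1ℚ) := ((K :- con 1ℚ) :- B) :+ (B :- x)) refl
          (seq x n) B (ℤ→ℚ K))))
    bounded)
  where
  -- From `B < 1 + k`, the choice `K = k + 2` leaves room for the uniform gap 1 in both strict
  -- inequalities.
  K : ℤ
  K = 1ℤ ℤ.+ (1ℤ ℤ.+ k)
  B<K-1 : B ℚ.< ℤ→ℚ K ℚ.- 1ℚ
  B<K-1 = subst (B ℚ.<_)
    (trans (solve 1 (λ k → con 1ℚ :+ k := (con 1ℚ :+ (con 1ℚ :+ k)) :- con 1ℚ) refl (ℤ→ℚ k))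
      (cong (ℚ._- 1ℚ) (sym (trans (ℤ→ℚ-homo-+ 1ℤ (1ℤ ℤ.+ k)) (cong (1ℚ ℚ.+_) (ℤ→ℚ-homo-+ 1ℤ k))))))
    B<1+k
  0<K : 0ℚ ℚ.< ℤ→ℚ K
  0<K = 0<q-p⇒p<q (+-positive (+-positive (p<q⇒0<q-p B<K-1) 0<B) (ℚ.positive⁻¹ 1ℚ))
    (solve 2 (λ B K → K :- con 0ℚ := ((K :- con 1ℚ) :- B :+ B) :+ con 1ℚ) refl B (ℤ→ℚ K))
  +∣K∣≡K : + ℤ.∣ K ∣ ≡ K
  +∣K∣≡K = ℤ.0≤i⇒+∣i∣≡i (ℤ.<⇒≤ (ℤ→ℚ-cancel-< 0<K))

-- A linear search upwards from `-m` with fuel `2 m`, keeping `k < x < k + n` at fuel `n`. The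
-- separation hypothesis decides each step, since a real cannot be compared with an integer in
-- general.
integer-part : ∀ {x} → (∀ k → x < fromℤ k ⊎ fromℤ k < x) →
  ∃[ k ] fromℤ k < x × x < fromℤ (1ℤ ℤ.+ k)
integer-part {x} separated =
  let m , -m<x , x<m = integer-bound x in
  search (m ℕ.+ m) (ℤ.- + m) -m<x (subst (λ k → x < fromℤ k) (sym (-m+2m≡m (+ m))) x<m)
  where
  -m+2m≡m : ∀ m → ℤ.- m ℤ.+ (m ℤ.+ m) ≡ m
  -m+2m≡m m = trans (sym (ℤ.+-assoc (ℤ.- m) m m))
    (trans (cong (ℤ._+ m) (ℤ.+-inverseˡ m)) (ℤ.+-identityˡ m))
  search : ∀ n k → fromℤ k < x → x < fromℤ (k ℤ.+ + n) → ∃[ k ] fromℤ k < x × x < fromℤ (1ℤ ℤ.+ k)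
  search zero k k<x x<k =
    ⊥-elim (<-asym {fromℤ k} {x} k<x (subst (λ k → x < fromℤ k) (ℤ.+-identityʳ k) x<k))
  search (suc n) k k<x x<k+1+n with separated (1ℤ ℤ.+ k)
  ... | inj₁ x<1+k = k , k<x , x<1+k
  ... | inj₂ 1+k<x = search n (1ℤ ℤ.+ k) 1+k<x
    (subst (λ k → x < fromℤ k)
      (trans (sym (ℤ.+-assoc k 1ℤ (+ n))) (cong (ℤ._+ + n) (ℤ.+-comm k 1ℤ))) x<k+1+n)

-- Integrality of the coefficients of the minimal polynomial

-- For `y = (u , v)`: membership of `u + v α` in the lattice `d⁻¹(ℤ + ℤα)`.
record InLattice (d : ℚ) (y : ℚ × ℚ) : Set where
  constructor _&_
  field
    int₁ : IsInt (d ℚ.* proj₁ y)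
    int₂ : IsInt (d ℚ.* proj₂ y)

open InLattice

-- The pair (u , v) stands for u + v α, where α² + a α + b = 0, and times-α for the
-- multiplication by α.
module QuadraticExtension (a b : ℚ) where

  times-α : ℚ × ℚ → ℚ × ℚ
  times-α (u , v) = ℚ.- (b ℚ.* v) , u ℚ.- a ℚ.* v

  _⊖_ : ℚ × ℚ → ℚ × ℚ → ℚ × ℚ
  (u , v) ⊖ (u′ , v′) = u ℚ.- u′ , v ℚ.- v′

  times-α-⊖ : ∀ y z → times-α (y ⊖ z) ≡ times-α y ⊖ times-α z
  times-α-⊖ (u , v) (u′ , v′) = cong₂ _,_
    (solve 3 (λ b v v′ → :- (b :* (v :- v′)) := (:- (b :* v)) :- (:- (b :* v′))) refl b v v′)
    (solve 5 (λ a u v u′ v′ → (u :- u′) :- a :* (v :- v′) :=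
      (u :- a :* v) :- (u′ :- a :* v′)) refl a u v u′ v′)

  -- The field norm `(u + v α)(u + v α′)`, where the conjugate α′ satisfies `α + α′ = -a` and
  -- `α α′ = b`.
  norm : ℚ × ℚ → ℚ
  norm (u , v) = u ℚ.* u ℚ.- a ℚ.* (u ℚ.* v) ℚ.+ b ℚ.* (v ℚ.* v)

  norm-times-α : ∀ y → norm (times-α y) ≡ b ℚ.* norm y
  norm-times-α (u , v) = solve 4 (λ a b u v →
    let u′ = :- (b :* v)
        v′ = u :- a :* v in
    u′ :* u′ :- a :* (u′ :* v′) :+ b :* (v′ :* v′) :=
    b :* (u :* u :- a :* (u :* v) :+ b :* (v :* v))) refl a b u v

  -- The factor is the norm of `α - 1`, that is, the value of `X² + aX + b` at 1. Together with the
  -- norm `b` of α it determines `a`.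
  norm-times-α-1 : ∀ y → norm (times-α y ⊖ y) ≡ (1ℚ ℚ.+ a ℚ.+ b) ℚ.* norm y
  norm-times-α-1 (u , v) = solve 4 (λ a b u v →
    let u′ = :- (b :* v) :- u
        v′ = u :- a :* v :- v in
    u′ :* u′ :- a :* (u′ :* v′) :+ b :* (v′ :* v′) :=
    (con 1ℚ :+ a :+ b) :* (u :* u :- a :* (u :* v) :+ b :* (v :* v))) refl a b u v

  ⊖-inLattice : ∀ {d} y z → InLattice d y → InLattice d z → InLattice d (y ⊖ z)
  ⊖-inLattice {d} (u , v) (u′ , v′) (p & q) (p′ & q′) =
    int-resp (distrib u u′) (int-+ p (int-neg p′)) &
    int-resp (distrib v v′) (int-+ q (int-neg q′))
    where
    distrib : ∀ x y → d ℚ.* x ℚ.- d ℚ.* y ≡ d ℚ.* (x ℚ.- y)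
    distrib = solve 3 (λ d x y → d :* x :- d :* y := d :* (x :- y)) refl d

  power : ℕ → ℚ × ℚ
  power zero    = 1ℚ , 0ℚ
  power (suc k) = times-α (power k)

  -- (α - 1)ᵐ αᵏ
  shifted-power : ℕ → ℕ → ℚ × ℚ
  shifted-power zero    k = power k
  shifted-power (suc m) k = shifted-power m (suc k) ⊖ shifted-power m k

  shifted-power-suc : ∀ m k → shifted-power m (suc k) ≡ times-α (shifted-power m k)
  shifted-power-suc zero    k = refl
  shifted-power-suc (suc m) k =
    trans (cong₂ _⊖_ (shifted-power-suc m (suc k)) (shifted-power-suc m k))
      (sym (times-α-⊖ (shifted-power m (suc k)) (shifted-power m k)))

  shifted-power-inLattice : ∀ {d} → (∀ k → InLattice d (power k)) →
    ∀ m k → InLattice d (shifted-power m k)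
  shifted-power-inLattice powers zero    k = powers k
  shifted-power-inLattice powers (suc m) k =
    ⊖-inLattice (shifted-power m (suc k)) (shifted-power m k)
      (shifted-power-inLattice powers m (suc k)) (shifted-power-inLattice powers m k)

  -- αᵏ p(α)
  power-times : ∀ {d} → Vec ℤ d → ℕ → ℚ × ℚ
  power-times []      k = power k
  power-times (c ∷ p) k =
    ℤ→ℚ c ℚ.* proj₁ (power k) ℚ.+ proj₁ (power-times p (suc k)) ,
    ℤ→ℚ c ℚ.* proj₂ (power k) ℚ.+ proj₂ (power-times p (suc k))

  -- The leading power is what remains of `αᵏ p(α)` once the lower terms, integer multiples of
  -- lattice elements, are subtracted. The recursion strips one coefficient at a time, starting with
  -- the constant one.
  leading-power-inLattice : ∀ {d m} (p : Vec ℤ m) k →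
    (∀ i → i ℕ.< m → InLattice d (power (i ℕ.+ k))) →
    InLattice d (power-times p k) → InLattice d (power (m ℕ.+ k))
  leading-power-inLattice []      k _      rel         = rel
  leading-power-inLattice {d} {suc m} (c ∷ p) k powers (rel₁ & rel₂) =
    subst (λ j → InLattice d (power j)) (ℕ.+-suc m k)
      (leading-power-inLattice p (suc k)
        (λ i i<m → subst (λ j → InLattice d (power j)) (sym (ℕ.+-suc i k)) (powers (suc i) (ℕ.s<s i<m)))
        (rest rel₁ (int₁ (powers 0 ℕ.z<s)) & rest rel₂ (int₂ (powers 0 ℕ.z<s))))
    where
    rest : ∀ {x y} → IsInt (d ℚ.* (ℤ→ℚ c ℚ.* x ℚ.+ y)) → IsInt (d ℚ.* x) → IsInt (d ℚ.* y)
    rest {x} {y} s t = int-resp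
      (solve 4 (λ d c x y → d :* (c :* x :+ y) :- c :* (d :* x) := d :* y) refl d (ℤ→ℚ c) x y)
      (int-+ s (int-neg (int-* (int c) t)))

  -- Since `αⁿ p(α) = 0`, the power with exponent `n + m` is an integer combination of the `m`
  -- powers before it; `below n` covers all exponents less than `n + m`.
  powers-inLattice : ∀ {d m} (p : Vec ℤ m) → (∀ k → power-times p k ≡ (0ℚ , 0ℚ)) →
    (∀ k → k ℕ.< m → InLattice d (power k)) → ∀ k → InLattice d (power k)
  powers-inLattice {d} {m} p p≡0 initial k = below (suc k) k (ℕ.m≤m+n (suc k) m)
    where
    0∈ : InLattice d (0ℚ , 0ℚ)
    0∈ = (0ℤ , ℚ.*-zeroʳ d) & (0ℤ , ℚ.*-zeroʳ d)
    below : ∀ n k → k ℕ.< n ℕ.+ m → InLattice d (power k)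
    below zero    k k<m = initial k k<m
    below (suc n) k k<1+n+m with ℕ.m≤n⇒m<n∨m≡n (ℕ.≤-pred k<1+n+m)
    ... | inj₁ k<n+m = below n k k<n+m
    ... | inj₂ k≡n+m = subst (λ k → InLattice d (power k)) (trans (ℕ.+-comm m n) (sym k≡n+m))
      (leading-power-inLattice p n
        (λ i i<m → below n (i ℕ.+ n) (subst (i ℕ.+ n ℕ.<_) (ℕ.+-comm m n) (ℕ.+-monoˡ-< n i<m)))
        (subst (InLattice d) (sym (p≡0 n)) 0∈))

  module _ {e} (0<e : 0ℚ ℚ.< e) (e-int : IsInt e)
           (ea-int : IsInt (e ℚ.* a)) (eb-int : IsInt (e ℚ.* b)) where

    -- Each multiplication by α costs at most one further factor `e` in the denominator, so `eᵐ`
    -- suffices.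
    initial-denominator : ∀ m → ∃[ d ] 0ℚ ℚ.< d × IsInt d ×
      (∀ k → k ℕ.< m → InLattice d (power k))
    initial-denominator zero    = 1ℚ , ℚ.positive⁻¹ 1ℚ , int 1ℤ , λ _ ()
    initial-denominator (suc m) with initial-denominator m
    ... | d , 0<d , d-int , powers = e ℚ.* d , *-positive 0<e 0<d , int-* e-int d-int , powers′
      where
      powers′ : ∀ k → k ℕ.< suc m → InLattice (e ℚ.* d) (power k)
      powers′ zero _ =
        int-resp (sym (ℚ.*-identityʳ (e ℚ.* d))) (int-* e-int d-int) & (0ℤ , ℚ.*-zeroʳ (e ℚ.* d))
      powers′ (suc k) k<m with powers k (ℕ.s<s⁻¹ k<m)
      ... | du-int & dv-int =
        int-resp
          (solve 4 (λ d e b v → :- ((e :* b) :* (d :* v)) := (e :* d) :* (:- (b :* v))) refl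
            d e b (proj₂ (power k)))
          (int-neg (int-* eb-int dv-int)) &
        int-resp
          (solve 5 (λ d e a u v → e :* (d :* u) :- (e :* a) :* (d :* v) :=
              (e :* d) :* (u :- a :* v)) refl
            d e a (proj₁ (power k)) (proj₂ (power k)))
          (int-+ (int-* e-int du-int) (int-neg (int-* ea-int dv-int)))

    -- The norm is a quadratic form with coefficients 1, `-a`, `b`, so `e * (d * d)` clears its
    -- values on the lattice. The norms of the `y k` form a geometric sequence with ratio `r`
    -- starting at 1, and the descent applies.
    norm-ratio-integral : ∀ {d r} → 0ℚ ℚ.< d → (y : ℕ → ℚ × ℚ) → y 0 ≡ (1ℚ , 0ℚ) →
      (∀ k → InLattice d (y k)) → (∀ k → norm (y (suc k)) ≡ r ℚ.* norm (y k)) → IsInt r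
    norm-ratio-integral {d} {r} 0<d y y₀≡1 y-in y-step =
      geometric-integral (λ k → e ℚ.* (d ℚ.* d) ℚ.* norm (y k))
        (subst (0ℚ ℚ.<_)
          (trans (solve 3 (λ c a b → c := c :* (con 1ℚ :* con 1ℚ :- a :* (con 1ℚ :* con 0ℚ)
                                                 :+ b :* (con 0ℚ :* con 0ℚ))) refl
                   (e ℚ.* (d ℚ.* d)) a b)
            (cong (λ y → e ℚ.* (d ℚ.* d) ℚ.* norm y) (sym y₀≡1)))
          (*-positive 0<e (*-positive 0<d 0<d)))
        (λ k → norm-int (y k) (y-in k))
        (λ k → trans (cong (e ℚ.* (d ℚ.* d) ℚ.*_) (y-step k))
          (solve 3 (λ c r n → c :* (r :* n) := r :* (c :* n)) refl (e ℚ.* (d ℚ.* d)) r (norm (y k))))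
      where
      norm-int : ∀ y → InLattice d y → IsInt (e ℚ.* (d ℚ.* d) ℚ.* norm y)
      norm-int (u , v) (du-int & dv-int) = int-resp
        (solve 6 (λ a b d e u v →
          e :* ((d :* u) :* (d :* u)) :- (e :* a) :* ((d :* u) :* (d :* v))
            :+ (e :* b) :* ((d :* v) :* (d :* v)) :=
          e :* (d :* d) :* (u :* u :- a :* (u :* v) :+ b :* (v :* v))) refl a b d e u v)
        (int-+ (int-+ (int-* e-int (int-* du-int du-int))
                      (int-neg (int-* ea-int (int-* du-int dv-int))))
               (int-* eb-int (int-* dv-int dv-int)))

    integral-of-powers : ∀ {d} → 0ℚ ℚ.< d → (∀ k → InLattice d (power k)) → IsInt a × IsInt b
    integral-of-powers {d} 0<d powers = a-int , b-int
      where
      b-int : IsInt b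
      b-int = norm-ratio-integral 0<d power refl powers (λ k → norm-times-α (power k))
      1+a+b-int : IsInt (1ℚ ℚ.+ a ℚ.+ b)
      1+a+b-int = norm-ratio-integral 0<d (λ m → shifted-power m 0) refl
        (λ m → shifted-power-inLattice powers m 0)
        (λ m → trans (cong (λ y → norm (y ⊖ shifted-power m 0)) (shifted-power-suc m 0))
          (norm-times-α-1 (shifted-power m 0)))
      a-int : IsInt a
      a-int = int-resp (solve 2 (λ a b → (con 1ℚ :+ a :+ b) :- b :- con 1ℚ := a) refl a b)
        (int-+ (int-+ 1+a+b-int (int-neg b-int)) (int-neg (int 1ℤ)))

  coefficients-integral : ∀ {m} (p : Vec ℤ m) → (∀ k → power-times p k ≡ (0ℚ , 0ℚ)) →
    IsInt a × IsInt b
  coefficients-integral {m} p p≡0 =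
    let e , 0<e , e-int , ea-int , eb-int = common-denominator a b
        d , 0<d , _ , initial = initial-denominator 0<e e-int ea-int eb-int m
    in integral-of-powers 0<e e-int ea-int eb-int 0<d (powers-inLattice p p≡0 initial)

  module _ {α} (root : IsQuadraticRoot α a b) where

    embed : ℚ × ℚ → ℝ
    embed (u , v) = fromℚ u + fromℚ v * α

    embed-times-α : ∀ y → embed (times-α y) ≈ α * embed y
    embed-times-α (u , v) = ≈-combine (fromℚ (ℚ.- v)) root λ n →
      solve 5 (λ a b u v α →
        (:- (b :* v)) :+ (u :- a :* v) :* α :- α :* (u :+ v :* α) :=
        (:- v) :* ((α :* α :+ a :* α :+ b) :- con 0ℚ)) refl a b u v (seq α n)

    embed-power-times : ∀ {m} (p : Vec ℤ m) k →
      embed (power-times p k) ≈ embed (power k) * evalMonic (map ℤ→ℚ p) α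
    embed-power-times []      k = ≈-pointwise λ n → sym (ℚ.*-identityʳ _)
    embed-power-times (c ∷ p) k = combined (power k) (power-times p (suc k)) (evalMonic (map ℤ→ℚ p) α)
      (embed-power-times p (suc k)) (embed-times-α (power k))
      where
      -- The pairs are generalised to variables, so that the solver treats their coordinates as
      -- atoms.
      combined : ∀ y z P → embed z ≈ embed (times-α y) * P → embed (times-α y) ≈ α * embed y →
        embed (ℤ→ℚ c ℚ.* proj₁ y ℚ.+ proj₁ z , ℤ→ℚ c ℚ.* proj₂ y ℚ.+ proj₂ z) ≈
        embed y * (fromℚ (ℤ→ℚ c) + α * P)
      combined y@(u , v) (u′ , v′) P h₁ h₂ = ≈-combine₂ 1ℝ P h₁ h₂ λ n →
        solve 8 (λ c u v u′ v′ α P w →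
          (c :* u :+ u′) :+ (c :* v :+ v′) :* α :- (u :+ v :* α) :* (c :+ α :* P) :=
          con 1ℚ :* ((u′ :+ v′ :* α) :- w :* P) :+ P :* (w :- α :* (u :+ v :* α))) refl
          (ℤ→ℚ c) u v u′ v′ (seq α n) (seq P n) (seq (embed (times-α y)) n)

    -- The real number represented by the pair is `αᵏ p(α)`, which vanishes; coordinates along 1 and
    -- α are unique for irrational α.
    relation-vanishes : Irrational α → ∀ {m} (p : Vec ℤ m) → α IsRootOf map ℤ→ℚ p →
      ∀ k → power-times p k ≡ (0ℚ , 0ℚ)
    relation-vanishes irr p pα≈0 k =
      let u≡0 , v≡0 = irrational-independent irr (proj₁ (power-times p k)) (proj₂ (power-times p k))
            (≈-combine₂ 1ℝ (embed (power k)) (embed-power-times p k) pα≈0 λ n →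
              solve 3 (λ x y P → x :- con 0ℚ := con 1ℚ :* (x :- y :* P) :+ y :* (P :- con 0ℚ)) refl
                (seq (embed (power-times p k)) n) (seq (embed (power k)) n)
                (seq (evalMonic (map ℤ→ℚ p) α) n))
      in cong₂ _,_ u≡0 v≡0

-- Translates of S

-- The working form of `QuadraticInteger`, shown below to be equivalent: irrationality stands for
-- the degree condition, and the integral equation is itself quadratic.
QuadraticIrrational : ℝ → Set
QuadraticIrrational α = Irrational α × ∃[ n ] ∃[ c ] IsQuadraticRoot α (ℤ→ℚ n) (ℤ→ℚ c)

integral-root : ∀ {α a b} → IsInt a → IsInt b → IsQuadraticRoot α a b →
  ∃[ n ] ∃[ c ] IsQuadraticRoot α (ℤ→ℚ n) (ℤ→ℚ c)
integral-root (n , refl) (c , refl) root = n , c , root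

quadraticInteger⇒irrational : ∀ {α} → QuadraticInteger α → QuadraticIrrational α
quadraticInteger⇒irrational {α} ((_ , p , pα≈0) , (b ∷ a ∷ [] , qα≈0) , minimal) =
  irr , integral-root (proj₁ integral) (proj₂ integral) root
  where
  irr : Irrational α
  irr q α≈q = minimal 1 (ℕ.s≤s (ℕ.s≤s ℕ.z≤n)) (ℚ.- q ∷ []) (≈-combine 1ℝ α≈q λ n →
    solve 2 (λ α q → (:- q) :+ α :* con 1ℚ :- con 0ℚ := con 1ℚ :* (α :- q)) refl (seq α n) q)
  root : IsQuadraticRoot α a b
  root = ≈-combine 1ℝ qα≈0 λ n → solve 3 (λ α a b →
    α :* α :+ a :* α :+ b :- con 0ℚ := con 1ℚ :* ((b :+ α :* (a :+ α :* con 1ℚ)) :- con 0ℚ)) refl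
    (seq α n) a b
  integral : IsInt a × IsInt b
  integral = coefficients-integral p (relation-vanishes root irr p pα≈0)
    where open QuadraticExtension a b

irrational⇒quadraticInteger : ∀ {α} → QuadraticIrrational α → QuadraticInteger α
irrational⇒quadraticInteger {α} (irr , n , c , root) =
  (2 , c ∷ n ∷ [] , vanishes) , (ℤ→ℚ c ∷ ℤ→ℚ n ∷ [] , vanishes) , minimal
  where
  vanishes : α IsRootOf (ℤ→ℚ c ∷ ℤ→ℚ n ∷ [])
  vanishes = ≈-combine 1ℝ root λ i → solve 3 (λ α a b →
    b :+ α :* (a :+ α :* con 1ℚ) :- con 0ℚ := con 1ℚ :* ((α :* α :+ a :* α :+ b) :- con 0ℚ)) refl
    (seq α i) (ℤ→ℚ n) (ℤ→ℚ c)
  minimal : ∀ e → e ℕ.< 2 → (p : Vec ℚ e) → ¬ (α IsRootOf p)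
  minimal 0 _ [] 1≈0 = ℚ.1≢0 (fromℚ-injective 1≈0)
  minimal 1 _ (q ∷ []) q+α≈0 = irr (ℚ.- q) (≈-combine 1ℝ q+α≈0 λ i →
    solve 2 (λ α q → α :- (:- q) := con 1ℚ :* ((q :+ α :* con 1ℚ) :- con 0ℚ)) refl (seq α i) q)
  minimal (suc (suc _)) (ℕ.s≤s (ℕ.s≤s ()))

irrational-affine : ∀ {α β q r} → Irrational α → r ≢ 0ℚ → β ≈ fromℚ q + fromℚ r * α → Irrational β
irrational-affine {α} {β} {q} {r} irr r≢0 β≈ s β≈s =
  r≢0 (proj₂ (irrational-independent irr (q ℚ.- s) r (≈-combine₂ 1ℝ (- 1ℝ) β≈s β≈ λ n →
    solve 5 (λ α β q r s → (q :- s) :+ r :* α :- con 0ℚ :=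
      con 1ℚ :* (β :- s) :+ (:- con 1ℚ) :* (β :- (q :+ r :* α))) refl (seq α n) (seq β n) q r s)))

-- The new coefficients are minus the trace and the norm of `q + r α`; they are integral whenever
-- `q`, `r`, `a` and `b` are.
affine-root : ∀ {α β a b} q r → IsQuadraticRoot α a b → β ≈ fromℚ q + fromℚ r * α →
  IsQuadraticRoot β (r ℚ.* a ℚ.- (q ℚ.+ q)) (q ℚ.* q ℚ.- q ℚ.* (r ℚ.* a) ℚ.+ r ℚ.* r ℚ.* b)
affine-root {α} {β} {a} {b} q r root β≈ =
  ≈-combine₂ (β + (fromℚ r * α + fromℚ (r ℚ.* a ℚ.- q))) (fromℚ (r ℚ.* r)) β≈ root λ n →
    solve 6 (λ α β a b q r →
      β :* β :+ (r :* a :- (q :+ q)) :* β :+ (q :* q :- q :* (r :* a) :+ r :* r :* b) :- con 0ℚ :=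
      (β :+ (r :* α :+ (r :* a :- q))) :* (β :- (q :+ r :* α)) :+
      (r :* r) :* ((α :* α :+ a :* α :+ b) :- con 0ℚ)) refl
    (seq α n) (seq β n) a b q r

quadraticIrrational-affine : ∀ {α β q r} → QuadraticIrrational α → IsInt q → IsInt r → r ≢ 0ℚ →
  β ≈ fromℚ q + fromℚ r * α → QuadraticIrrational β
quadraticIrrational-affine {q = q} {r} (irr , n , c , root) q-int r-int r≢0 β≈ =
  irrational-affine irr r≢0 β≈ ,
  integral-root
    (int-+ (int-* r-int (int n)) (int-neg (int-+ q-int q-int)))
    (int-+ (int-+ (int-* q-int q-int) (int-neg (int-* q-int (int-* r-int (int n)))))
           (int-* (int-* r-int r-int) (int c)))
    (affine-root q r root β≈)

-- Subtracting the equations leaves a linear relation between 1 and α.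
root-unique : ∀ {α a b a′ b′} → Irrational α → IsQuadraticRoot α a b → IsQuadraticRoot α a′ b′ →
  a ≡ a′
root-unique {α} {a} {b} {a′} {b′} irr root root′ = p-q≡0⇒p≡q (proj₂
  (irrational-independent irr (b ℚ.- b′) (a ℚ.- a′) (≈-combine₂ 1ℝ (- 1ℝ) root root′ λ n →
    solve 5 (λ α a b a′ b′ → (b :- b′) :+ (a :- a′) :* α :- con 0ℚ :=
      con 1ℚ :* ((α :* α :+ a :* α :+ b) :- con 0ℚ) :+
      (:- con 1ℚ) :* ((α :* α :+ a′ :* α :+ b′) :- con 0ℚ)) refl (seq α n) a b a′ b′)))

-- By the equation, two consecutive integral terms of the sequence `d qᵏ` make the next one
-- integral, so the powers of `q` have the common denominator `d`.
rational-root-integral : ∀ {a b q} → IsInt a → IsInt b →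
  q ℚ.* q ℚ.+ a ℚ.* q ℚ.+ b ≡ 0ℚ → IsInt q
rational-root-integral {a} {b} {q} a-int b-int root =
  let d , 0<d , d-int , dq-int , _ = common-denominator q 0ℚ
  in geometric-integral (geometric d) 0<d
       (λ k → proj₁ (consecutive d d-int (int-resp (ℚ.*-comm d q) dq-int) k)) (λ _ → refl)
  where
  geometric : ℚ → ℕ → ℚ
  geometric d zero    = d
  geometric d (suc k) = q ℚ.* geometric d k
  consecutive : ∀ d → IsInt d → IsInt (q ℚ.* d) → ∀ k →
    IsInt (geometric d k) × IsInt (q ℚ.* geometric d k)
  consecutive d d-int qd-int zero    = d-int , qd-int
  consecutive d d-int qd-int (suc k) with consecutive d d-int qd-int k
  ... | x-int , qx-int = qx-int , int-resp (sym (reduce (geometric d k)))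
          (int-neg (int-+ (int-* a-int qx-int) (int-* b-int x-int)))
    where
    open ≡-Reasoning
    reduce : ∀ x → q ℚ.* (q ℚ.* x) ≡ ℚ.- (a ℚ.* (q ℚ.* x) ℚ.+ b ℚ.* x)
    reduce x = begin
      q ℚ.* (q ℚ.* x)
        ≡⟨ solve 4 (λ a b q x → q :* (q :* x) :=
             (q :* q :+ a :* q :+ b) :* x :- (a :* (q :* x) :+ b :* x)) refl a b q x ⟩
      (q ℚ.* q ℚ.+ a ℚ.* q ℚ.+ b) ℚ.* x ℚ.- (a ℚ.* (q ℚ.* x) ℚ.+ b ℚ.* x)
        ≡⟨ cong (λ e → e ℚ.* x ℚ.- (a ℚ.* (q ℚ.* x) ℚ.+ b ℚ.* x)) root ⟩
      0ℚ ℚ.* x ℚ.- (a ℚ.* (q ℚ.* x) ℚ.+ b ℚ.* x)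
        ≡⟨ solve 2 (λ x y → con 0ℚ :* x :- y := :- y) refl x _ ⟩
      ℚ.- (a ℚ.* (q ℚ.* x) ℚ.+ b ℚ.* x) ∎

fromℚ-cancel-< : ∀ {p q} → fromℚ p < fromℚ q → p ℚ.< q
fromℚ-cancel-< {p} {q} (ε , 0<ε , p<q) =
  ℚ.<-trans (0<q-p⇒p<q 0<ε (solve 2 (λ p ε → (p :+ ε) :- p := ε) refl p ε))
    (proj₂ (eventually-witness p<q))

-- A rational root of a monic polynomial over ℤ is an integer, and no integer lies strictly between
-- 0 and 1.
S-irrational : ∀ {α} → α ∈ S²ʳ → QuadraticIrrational α
S-irrational {α} (n , _ , (0<α , α<1) , c , _ , root) = irr , n , c , root
  where
  irr : Irrational α
  irr q α≈q = no-integer (rational-root-integral (int n) (int c) (fromℚ-injective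
      (≈-combine₂ 1ℝ (- (α + fromℚ (q ℚ.+ ℤ→ℚ n))) root α≈q λ i →
        solve 4 (λ α q a b → (q :* q :+ a :* q :+ b) :- con 0ℚ :=
          con 1ℚ :* ((α :* α :+ a :* α :+ b) :- con 0ℚ) :+ (:- (α :+ (q :+ a))) :* (α :- q)) refl
          (seq α i) q (ℤ→ℚ n) (ℤ→ℚ c))))
    where
    0<q : 0ℚ ℚ.< q
    0<q = fromℚ-cancel-< (<-combine {0ℝ} {α} {0ℝ} {fromℚ q} 0<α (≈-combine (- 1ℝ) α≈q λ i →
      solve 2 (λ α q → (q :- con 0ℚ) :- (α :- con 0ℚ) := (:- con 1ℚ) :* (α :- q)) refl (seq α i) q))
    q<1 : q ℚ.< 1ℚ
    q<1 = fromℚ-cancel-< (<-combine {α} {1ℝ} {fromℚ q} {1ℝ} α<1 (≈-combine 1ℝ α≈q λ i →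
      solve 2 (λ α q → (con 1ℚ :- q) :- (con 1ℚ :- α) := con 1ℚ :* (α :- q)) refl (seq α i) q))
    no-integer : ¬ IsInt q
    no-integer (k , q≡k) = ℤ.<-irrefl refl (ℤ.≤-<-trans
      (ℤ.i<j⇒suc[i]≤j (ℤ→ℚ-cancel-< {0ℤ} {k} (subst (0ℚ ℚ.<_) q≡k 0<q)))
      (ℤ→ℚ-cancel-< {k} {1ℤ} (subst (ℚ._< 1ℚ) q≡k q<1)))

-- With f = X² + nX + c and 0 < x < 1, f(x) = x f(1) + (1 - x) f(0) - x(1 - x), so that
-- f(0) and f(1) cannot both be ≤ 0.
negative-constant⇒bounded : ∀ {α n c} → 0ℝ < α → α < 1ℝ → IsQuadraticRoot α (ℤ→ℚ n) (ℤ→ℚ c) →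
  c ℤ.≤ -1ℤ → ℤ.- n ℤ.≤ c
negative-constant⇒bounded {α} {n} {c} (ε , 0<ε , 0<α) (δ , 0<δ , α<1) root c≤-1 =
  ℤ.≮⇒≥ λ c<-n → contradiction c<-n
    (eventually-witness (eventually-zip (eventually-zip 0<α α<1) (close root δ 0<δ)))
  where
  contradiction : c ℤ.< ℤ.- n →
    ¬ (∃[ i ] ((0ℚ ℚ.+ ε ℚ.< seq α i × seq α i ℚ.+ δ ℚ.< 1ℚ) ×
      ∣ seq α i ℚ.* seq α i ℚ.+ ℤ→ℚ n ℚ.* seq α i ℚ.+ ℤ→ℚ c ℚ.- 0ℚ ∣ ℚ.< δ))
  -- The summands are nonnegative, some strictly positive, yet they add up to 0. The error of `f(x)`
  -- at the index `i` is below δ and is absorbed by `1 - x > δ`.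
  contradiction c<-n (i , (ε<x , x+δ<1) , near) = ℚ.<-irrefl (sym sum≡0)
    (ℚ.+-mono-<-≤ (+-positive (+-positive (p<q⇒0<q-p (∣p∣<q⇒-p<q near)) (p<q⇒0<q-p x+δ<1))
                    (*-positive 0<x 0<1-x))
      (ℚ.+-mono-≤
        (*-nonNegative (ℚ.<⇒≤ 0<x) f₁≤0)
        (*-nonNegative (ℚ.<⇒≤ 0<1-x) (p≤q⇒0≤q-p (ℤ→ℚ-mono-≤ c≤-1)))))
    where
    x a b : ℚ
    x = seq α i
    a = ℤ→ℚ n
    b = ℤ→ℚ c
    0<x : 0ℚ ℚ.< x
    0<x = ℚ.<-trans 0<ε (subst (ℚ._< x) (ℚ.+-identityˡ ε) ε<x)
    0<1-x : 0ℚ ℚ.< 1ℚ ℚ.- x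
    0<1-x = subst (0ℚ ℚ.<_) (solve 2 (λ x δ → (con 1ℚ :- (x :+ δ)) :+ δ := con 1ℚ :- x) refl x δ)
      (+-positive (p<q⇒0<q-p x+δ<1) 0<δ)
    f₁≤0 : 0ℚ ℚ.≤ ℚ.- a ℚ.- (1ℚ ℚ.+ b)
    f₁≤0 = subst₂ (λ p q → 0ℚ ℚ.≤ p ℚ.- q) (ℤ→ℚ-homo‿- n) (ℤ→ℚ-homo-+ 1ℤ c)
      (p≤q⇒0≤q-p (ℤ→ℚ-mono-≤ (ℤ.i<j⇒suc[i]≤j c<-n)))
    sum≡0 : (δ ℚ.- (ℚ.- (x ℚ.* x ℚ.+ a ℚ.* x ℚ.+ b ℚ.- 0ℚ))) ℚ.+ (1ℚ ℚ.- (x ℚ.+ δ)) ℚ.+ x ℚ.* (1ℚ ℚ.- x)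
      ℚ.+ (x ℚ.* (ℚ.- a ℚ.- (1ℚ ℚ.+ b)) ℚ.+ (1ℚ ℚ.- x) ℚ.* (ℤ→ℚ -1ℤ ℚ.- b)) ≡ 0ℚ
    sum≡0 = solve 4 (λ δ x a b →
      (δ :- (:- (x :* x :+ a :* x :+ b :- con 0ℚ))) :+ (con 1ℚ :- (x :+ δ)) :+ x :* (con 1ℚ :- x)
      :+ (x :* ((:- a) :- (con 1ℚ :+ b)) :+ (con 1ℚ :- x) :* (con (ℤ→ℚ -1ℤ) :- b)) := con 0ℚ) refl
      δ x a b

-- Here f(x) = x f(1) + (1 - x)(f(0) - 1) + (1 - x)².
positive-constant⇒value-at-1 : ∀ {α n c} → 0ℝ < α → α < 1ℝ →
  IsQuadraticRoot α (ℤ→ℚ n) (ℤ→ℚ c) → 1ℤ ℤ.≤ c → 1ℤ ℤ.+ n ℤ.+ c ℤ.≤ -1ℤ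
positive-constant⇒value-at-1 {α} {n} {c} (ε , 0<ε , 0<α) (δ , 0<δ , α<1) root 1≤c =
  ℤ.i<j⇒i≤pred[j] (ℤ.≰⇒> λ 0≤f₁ → contradiction 0≤f₁
    (eventually-witness
      -- The tolerance is `δ * δ` because `(1 - x)²` exceeds it when `x + δ < 1`.
      (eventually-zip (eventually-zip 0<α α<1) (close root (δ ℚ.* δ) (*-positive 0<δ 0<δ)))))
  where
  contradiction : 0ℤ ℤ.≤ 1ℤ ℤ.+ n ℤ.+ c →
    ¬ (∃[ i ] ((0ℚ ℚ.+ ε ℚ.< seq α i × seq α i ℚ.+ δ ℚ.< 1ℚ) ×
      ∣ seq α i ℚ.* seq α i ℚ.+ ℤ→ℚ n ℚ.* seq α i ℚ.+ ℤ→ℚ c ℚ.- 0ℚ ∣ ℚ.< δ ℚ.* δ))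
  contradiction 0≤f₁ (i , (ε<x , x+δ<1) , near) = ℚ.<-irrefl (sym sum≡0)
    (ℚ.+-mono-<-≤ (+-positive (p<q⇒0<q-p (∣p∣<q⇒p<q near))
                    (*-positive (p<q⇒0<q-p x+δ<1) (+-positive 0<1-x 0<δ)))
      (ℚ.+-mono-≤
        (*-nonNegative (ℚ.<⇒≤ 0<x) 0≤f₁′)
        (*-nonNegative (ℚ.<⇒≤ 0<1-x) (p≤q⇒0≤q-p (ℤ→ℚ-mono-≤ 1≤c)))))
    where
    x a b : ℚ
    x = seq α i
    a = ℤ→ℚ n
    b = ℤ→ℚ c
    0<x : 0ℚ ℚ.< x
    0<x = ℚ.<-trans 0<ε (subst (ℚ._< x) (ℚ.+-identityˡ ε) ε<x)
    0<1-x : 0ℚ ℚ.< 1ℚ ℚ.- x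
    0<1-x = subst (0ℚ ℚ.<_) (solve 2 (λ x δ → (con 1ℚ :- (x :+ δ)) :+ δ := con 1ℚ :- x) refl x δ)
      (+-positive (p<q⇒0<q-p x+δ<1) 0<δ)
    0≤f₁′ : 0ℚ ℚ.≤ 1ℚ ℚ.+ a ℚ.+ b
    0≤f₁′ = subst (0ℚ ℚ.≤_)
      (trans (ℤ→ℚ-homo-+ (1ℤ ℤ.+ n) c) (cong (ℚ._+ b) (ℤ→ℚ-homo-+ 1ℤ n))) (ℤ→ℚ-mono-≤ 0≤f₁)
    sum≡0 : (δ ℚ.* δ ℚ.- (x ℚ.* x ℚ.+ a ℚ.* x ℚ.+ b ℚ.- 0ℚ)) ℚ.+ (1ℚ ℚ.- (x ℚ.+ δ)) ℚ.* (1ℚ ℚ.- x ℚ.+ δ)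
      ℚ.+ (x ℚ.* (1ℚ ℚ.+ a ℚ.+ b) ℚ.+ (1ℚ ℚ.- x) ℚ.* (b ℚ.- 1ℚ)) ≡ 0ℚ
    sum≡0 = solve 4 (λ δ x a b →
      (δ :* δ :- (x :* x :+ a :* x :+ b :- con 0ℚ)) :+ (con 1ℚ :- (x :+ δ)) :* (con 1ℚ :- x :+ δ)
      :+ (x :* (con 1ℚ :+ a :+ b) :+ (con 1ℚ :- x) :* (b :- con 1ℚ)) := con 0ℚ) refl
      δ x a b

-- The unit interval and the reflection `α ↦ 1 - α`.

negative-constant⇒S : ∀ {α n c} → 0ℝ < α → α < 1ℝ → IsQuadraticRoot α (ℤ→ℚ n) (ℤ→ℚ c) →
  c ℤ.≤ -1ℤ → α ∈ S²ʳ
negative-constant⇒S {α} {n} {c} 0<α α<1 root c≤-1 =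
  n , ℤ.neg-cancel-≤ (ℤ.≤-trans -n≤c c≤-1) , (0<α , α<1) , c , (-n≤c , c≤-1) , root
  where
  -n≤c : ℤ.- n ℤ.≤ c
  -n≤c = negative-constant⇒bounded {α} {n} {c} 0<α α<1 root c≤-1

complement : ℝ → ℝ
complement α = 1ℝ + - α

complement-affine : ∀ α → complement α ≈ 1ℝ + fromℚ (ℚ.- 1ℚ) * α
complement-affine α = ≈-pointwise λ n →
  solve 1 (λ α → con 1ℚ :- α := con 1ℚ :+ (:- con 1ℚ) :* α) refl (seq α n)

complement-positive : ∀ {α} → α < 1ℝ → 0ℝ < complement α
complement-positive {α} α<1 = <-combine {α} {1ℝ} {0ℝ} {complement α} α<1 (≈-pointwise λ n →
  solve 1 (λ α → (con 1ℚ :- α) :- con 0ℚ := con 1ℚ :- α) refl (seq α n))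

complement-<1 : ∀ {α} → 0ℝ < α → complement α < 1ℝ
complement-<1 {α} 0<α = <-combine {0ℝ} {α} {complement α} {1ℝ} 0<α (≈-pointwise λ n →
  solve 1 (λ α → con 1ℚ :- (con 1ℚ :- α) := α :- con 0ℚ) refl (seq α n))

-- Expanding `f(1 - X)` gives `X² - (n + 2)X + f(1)`.
complement-root : ∀ {α} n c → IsQuadraticRoot α (ℤ→ℚ n) (ℤ→ℚ c) →
  IsQuadraticRoot (complement α) (ℤ→ℚ (ℤ.- (1ℤ ℤ.+ (1ℤ ℤ.+ n)))) (ℤ→ℚ (1ℤ ℤ.+ n ℤ.+ c))
complement-root {α} n c root =
  subst₂ (IsQuadraticRoot (complement α)) linear constant
    (affine-root 1ℚ (ℚ.- 1ℚ) root (complement-affine α))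
  where
  open ≡-Reasoning
  linear : ℚ.- 1ℚ ℚ.* ℤ→ℚ n ℚ.- (1ℚ ℚ.+ 1ℚ) ≡ ℤ→ℚ (ℤ.- (1ℤ ℤ.+ (1ℤ ℤ.+ n)))
  linear = begin
    ℚ.- 1ℚ ℚ.* ℤ→ℚ n ℚ.- (1ℚ ℚ.+ 1ℚ)
      ≡⟨ solve 1 (λ a → (:- con 1ℚ) :* a :- (con 1ℚ :+ con 1ℚ) := :- (con 1ℚ :+ (con 1ℚ :+ a))) refl (ℤ→ℚ n) ⟩
    ℚ.- (1ℚ ℚ.+ (1ℚ ℚ.+ ℤ→ℚ n))
      ≡⟨ cong (λ e → ℚ.- (1ℚ ℚ.+ e)) (ℤ→ℚ-homo-+ 1ℤ n) ⟨
    ℚ.- (1ℚ ℚ.+ ℤ→ℚ (1ℤ ℤ.+ n))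
      ≡⟨ cong ℚ.-_ (ℤ→ℚ-homo-+ 1ℤ (1ℤ ℤ.+ n)) ⟨
    ℚ.- ℤ→ℚ (1ℤ ℤ.+ (1ℤ ℤ.+ n))
      ≡⟨ ℤ→ℚ-homo‿- (1ℤ ℤ.+ (1ℤ ℤ.+ n)) ⟨
    ℤ→ℚ (ℤ.- (1ℤ ℤ.+ (1ℤ ℤ.+ n))) ∎
  constant : 1ℚ ℚ.* 1ℚ ℚ.- 1ℚ ℚ.* (ℚ.- 1ℚ ℚ.* ℤ→ℚ n) ℚ.+ ℚ.- 1ℚ ℚ.* ℚ.- 1ℚ ℚ.* ℤ→ℚ c ≡
    ℤ→ℚ (1ℤ ℤ.+ n ℤ.+ c)
  constant = begin
    1ℚ ℚ.* 1ℚ ℚ.- 1ℚ ℚ.* (ℚ.- 1ℚ ℚ.* ℤ→ℚ n) ℚ.+ ℚ.- 1ℚ ℚ.* ℚ.- 1ℚ ℚ.* ℤ→ℚ c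
      ≡⟨ solve 2 (λ a b → con 1ℚ :* con 1ℚ :- con 1ℚ :* ((:- con 1ℚ) :* a)
                    :+ (:- con 1ℚ) :* (:- con 1ℚ) :* b := con 1ℚ :+ a :+ b) refl (ℤ→ℚ n) (ℤ→ℚ c) ⟩
    1ℚ ℚ.+ ℤ→ℚ n ℚ.+ ℤ→ℚ c
      ≡⟨ cong (ℚ._+ ℤ→ℚ c) (ℤ→ℚ-homo-+ 1ℤ n) ⟨
    ℤ→ℚ (1ℤ ℤ.+ n) ℚ.+ ℤ→ℚ c
      ≡⟨ ℤ→ℚ-homo-+ (1ℤ ℤ.+ n) c ⟨
    ℤ→ℚ (1ℤ ℤ.+ n ℤ.+ c) ∎

irrational-root-constant≢0 : ∀ {α a b} → Irrational α → IsQuadraticRoot α a b → b ≢ 0ℚ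
irrational-root-constant≢0 {α} {a} irr root refl = irr (ℚ.- a) (≈-combine 1ℝ α+a≈0 λ n →
  solve 2 (λ α a → α :- (:- a) := con 1ℚ :* ((α :+ a) :- con 0ℚ)) refl (seq α n) a)
  where
  α+a≈0 : α + fromℚ a ≈ 0ℝ
  α+a≈0 = integral-domain {α} (≈-combine 1ℝ root λ n → solve 2 (λ α a →
    α :* (α :+ a) :- con 0ℚ := con 1ℚ :* ((α :* α :+ a :* α :+ con 0ℚ) :- con 0ℚ)) refl
    (seq α n) a) (irr 0ℚ)

unit-interval-dichotomy : ∀ {α} → 0ℝ < α → α < 1ℝ → QuadraticIrrational α →
  α ∈ S²ʳ ⊎ complement α ∈ S²ʳ
unit-interval-dichotomy {α} 0<α α<1 (irr , n , c , root) with ℤ.<-cmp c 0ℤ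
... | tri< c<0 _ _ = inj₁ (negative-constant⇒S {α} {n} {c} 0<α α<1 root (ℤ.i<j⇒i≤pred[j] c<0))
... | tri≈ _ c≡0 _ = ⊥-elim (irrational-root-constant≢0 irr root (cong ℤ→ℚ c≡0))
... | tri> _ _ 0<c = inj₂ (negative-constant⇒S
  {complement α} {ℤ.- (1ℤ ℤ.+ (1ℤ ℤ.+ n))} {1ℤ ℤ.+ n ℤ.+ c}
  (complement-positive {α} α<1) (complement-<1 {α} 0<α) (complement-root n c root)
  (positive-constant⇒value-at-1 {α} {n} {c} 0<α α<1 root (ℤ.i<j⇒suc[i]≤j 0<c)))

-- Covering by translates and their disjointness.

classification : ∀ {β} → QuadraticIrrational β → ∃[ n ] ∃[ ε ] β ∈ ((ε ◃ₛ S²ʳ) +ₛ n)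
classification {β} qi@(irr , a , b , root) =
  let k , k<β , β<1+k = integer-part {β} (λ k → irrational-root-separated irr root (ℤ→ℚ k))
  in from-part k k<β β<1+k
  where
  from-part : ∀ k → fromℤ k < β → β < fromℤ (1ℤ ℤ.+ k) → ∃[ n ] ∃[ ε ] β ∈ ((ε ◃ₛ S²ʳ) +ₛ n)
  from-part k k<β β<1+k = Sum.[ in-S , in-minus-S ]′
    (unit-interval-dichotomy {α} 0<α α<1 (quadraticIrrational-affine {β} {α} {ℚ.- ℤ→ℚ k} {1ℚ} qi
      (int-neg (int k)) (int 1ℤ) ℚ.1≢0 (≈-pointwise λ n →
        solve 2 (λ β k → β :- k := (:- k) :+ con 1ℚ :* β) refl (seq β n) (ℤ→ℚ k))))
    where
    α : ℝ
    α = β + - fromℤ k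
    0<α : 0ℝ < α
    0<α = <-combine {fromℤ k} {β} {0ℝ} {α} k<β (≈-pointwise λ n →
      solve 2 (λ β k → (β :- k) :- con 0ℚ := β :- k) refl (seq β n) (ℤ→ℚ k))
    α<1 : α < 1ℝ
    α<1 = <-combine {β} {fromℤ (1ℤ ℤ.+ k)} {α} {1ℝ} β<1+k (≈-pointwise λ n → trans
      (solve 2 (λ β k → con 1ℚ :- (β :- k) := (con 1ℚ :+ k) :- β) refl (seq β n) (ℤ→ℚ k))
      (cong (ℚ._- seq β n) (sym (ℤ→ℚ-homo-+ 1ℤ k))))
    in-S : α ∈ S²ʳ → ∃[ n ] ∃[ ε ] β ∈ ((ε ◃ₛ S²ʳ) +ₛ n)
    in-S α∈S = k , Sign.+ , α , α∈S , ≈-pointwise λ n →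
      solve 2 (λ β k → β := (β :- k) :+ k) refl (seq β n) (ℤ→ℚ k)
    -- Here `β = k + α = -(1 - α) + (k + 1)`, so the translation is by `1 + k`.
    in-minus-S : complement α ∈ S²ʳ → ∃[ n ] ∃[ ε ] β ∈ ((ε ◃ₛ S²ʳ) +ₛ n)
    in-minus-S α∈S = 1ℤ ℤ.+ k , Sign.- , - complement α , (complement α , α∈S , ≈-refl) ,
      ≈-pointwise λ n → trans
        (solve 2 (λ β k → β := (:- (con 1ℚ :- (β :- k))) :+ (con 1ℚ :+ k)) refl (seq β n) (ℤ→ℚ k))
        (cong (λ e → ℚ.- (1ℚ ℚ.- (seq β n ℚ.- ℤ→ℚ k)) ℚ.+ e) (sym (ℤ→ℚ-homo-+ 1ℤ k)))

-- Treats both signs at once, with σ equal to 1 or -1; the equation `σ * σ ≡ 1ℚ` is what allows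
-- solving for α.
translate-affine : ∀ ε n {β} → β ∈ ((ε ◃ₛ S²ʳ) +ₛ n) →
  ∃[ α ] α ∈ S²ʳ × ∃[ σ ] IsInt σ × σ ℚ.* σ ≡ 1ℚ × β ≈ fromℤ n + fromℚ σ * α
translate-affine Sign.+ n {β} (α , α∈S , β≈α+n) =
  α , α∈S , 1ℚ , int 1ℤ , refl ,
  ≈-combine 1ℝ β≈α+n λ i → solve 3 (λ α β n →
    β :- (n :+ con 1ℚ :* α) := con 1ℚ :* (β :- (α :+ n))) refl (seq α i) (seq β i) (ℤ→ℚ n)
translate-affine Sign.- n {β} (γ , (α , α∈S , γ≈-α) , β≈γ+n) =
  α , α∈S , ℚ.- 1ℚ , int -1ℤ , refl ,
  ≈-combine₂ 1ℝ 1ℝ β≈γ+n γ≈-α λ i → solve 4 (λ α β γ n →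
    β :- (n :+ (:- con 1ℚ) :* α) := con 1ℚ :* (β :- (γ :+ n)) :+ con 1ℚ :* (γ :- (:- α))) refl
    (seq α i) (seq β i) (seq γ i) (ℤ→ℚ n)

translate-irrational : ∀ ε n {β} → β ∈ ((ε ◃ₛ S²ʳ) +ₛ n) → QuadraticIrrational β
translate-irrational ε n {β} β∈ =
  let α , α∈S , σ , σ-int , σσ≡1 , β≈ = translate-affine ε n β∈
  in quadraticIrrational-affine {α} {β} {ℤ→ℚ n} {σ} (S-irrational α∈S) (int n) σ-int
       (λ σ≡0 → ℚ.1≢0 (trans (sym σσ≡1) (trans (cong (ℚ._* σ) σ≡0) (ℚ.*-zeroˡ σ)))) β≈

-- The difference `m - n` equals `γ - α`, which is less than 1.
integer-translate-≤ : ∀ {α γ} m n → 0ℝ < α → γ < 1ℝ → α + fromℤ m ≈ γ + fromℤ n → m ℤ.≤ n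
integer-translate-≤ {α} {γ} m n (ε , 0<ε , 0<α) (δ , 0<δ , γ<1) eq =
  conclude (eventually-witness (eventually-zip (eventually-zip 0<α γ<1) (close eq ε 0<ε)))
  where
  conclude : ∃[ i ] ((0ℚ ℚ.+ ε ℚ.< seq α i × seq γ i ℚ.+ δ ℚ.< 1ℚ) ×
    ∣ seq α i ℚ.+ ℤ→ℚ m ℚ.- (seq γ i ℚ.+ ℤ→ℚ n) ∣ ℚ.< ε) → m ℤ.≤ n
  conclude (i , (ε<x , y+δ<1) , near) = ℤ.≮⇒≥ λ n<m → ℚ.<-irrefl refl (ℚ.<-≤-trans
    (0<q-p⇒p<q (+-positive (+-positive (p<q⇒0<q-p ε<x) (p<q⇒0<q-p y+δ<1))
                 (+-positive (p<q⇒0<q-p (∣p∣<q⇒p<q near)) 0<δ))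
      (solve 6 (λ x y m n ε δ → (con 1ℚ :+ n) :- m :=
        ((x :- (con 0ℚ :+ ε)) :+ (con 1ℚ :- (y :+ δ))) :+ ((ε :- ((x :+ m) :- (y :+ n))) :+ δ)) refl
        (seq α i) (seq γ i) (ℤ→ℚ m) (ℤ→ℚ n) ε δ))
    (subst (ℚ._≤ ℤ→ℚ m) (ℤ→ℚ-homo-+ 1ℤ n) (ℤ→ℚ-mono-≤ (ℤ.i<j⇒suc[i]≤j n<m))))

integer-translate-unique : ∀ {α γ} m n → 0ℝ < α → α < 1ℝ → 0ℝ < γ → γ < 1ℝ →
  α + fromℤ m ≈ γ + fromℤ n → m ≡ n
integer-translate-unique {α} {γ} m n 0<α α<1 0<γ γ<1 eq = ℤ.≤-antisym
  (integer-translate-≤ {α} {γ} m n 0<α γ<1 eq)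
  (integer-translate-≤ {γ} {α} n m 0<γ α<1 (≈-sym eq))

S+m∩-S+n≡∅ : ∀ {α γ} m n → α ∈ S²ʳ → γ ∈ S²ʳ → ¬ (α + fromℤ m ≈ - γ + fromℤ n)
S+m∩-S+n≡∅ {α} {γ} m n α∈S@(a , 1≤a , (0<α , α<1) , b , _ , rootα)
    (c , 1≤c , (0<γ , γ<1) , d , _ , rootγ) eq =
  linear-terms-differ (ℤ→ℚ-injective (root-unique (proj₁ (S-irrational α∈S)) rootα rootα′))
  where
  -- Written as `(1 - γ) + (n - 1)`, the right side also has its first summand in (0, 1), so the
  -- integer parts can be compared.
  shifted : α + fromℤ m ≈ complement γ + fromℤ (n ℤ.- 1ℤ)
  shifted = ≈-trans eq (≈-pointwise λ i → trans
    (solve 2 (λ γ n → (:- γ) :+ n := (con 1ℚ :- γ) :+ (n :- con 1ℚ)) refl (seq γ i) (ℤ→ℚ n))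
    (cong (1ℚ ℚ.- seq γ i ℚ.+_) (sym (ℤ→ℚ-homo-+ n -1ℤ))))
  m≡n-1 : m ≡ n ℤ.- 1ℤ
  m≡n-1 = integer-translate-unique {α} {complement γ} m (n ℤ.- 1ℤ) 0<α α<1
    (complement-positive {γ} γ<1) (complement-<1 {γ} 0<γ) shifted
  α≈1-γ : α ≈ complement γ
  α≈1-γ = ≈-combine 1ℝ (subst (λ k → α + fromℤ m ≈ complement γ + fromℤ k) (sym m≡n-1) shifted) λ i →
    solve 3 (λ x y m → x :- y := con 1ℚ :* ((x :+ m) :- (y :+ m))) refl
      (seq α i) (seq (complement γ) i) (ℤ→ℚ m)
  n′ c′ : ℤ
  n′ = ℤ.- (1ℤ ℤ.+ (1ℤ ℤ.+ c))
  c′ = 1ℤ ℤ.+ c ℤ.+ d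
  rootα′ : IsQuadraticRoot α (ℤ→ℚ n′) (ℤ→ℚ c′)
  rootα′ = ≈-combine₂ (α + (complement γ + fromℤ n′)) 1ℝ α≈1-γ (complement-root c d rootγ) λ i →
    solve 4 (λ x y a b → x :* x :+ a :* x :+ b :- con 0ℚ :=
      (x :+ (y :+ a)) :* (x :- y) :+ con 1ℚ :* ((y :* y :+ a :* y :+ b) :- con 0ℚ)) refl
      (seq α i) (seq (complement γ) i) (ℤ→ℚ n′) (ℤ→ℚ c′)
  linear-terms-differ : a ≢ n′
  linear-terms-differ a≡n′ = positive≢negative 1≤a 1≤c a≡n′
    where
    positive≢negative : ∀ {a c} → 1ℤ ℤ.≤ a → 1ℤ ℤ.≤ c → a ≢ ℤ.- (1ℤ ℤ.+ (1ℤ ℤ.+ c))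
    -- The bounds exclude negative arguments, and the right side then computes to a negative
    -- integer.
    positive≢negative {+ _} {+ _} _ _ ()

-- Real quadratic fields

module _ {ℓ} {K : Pred ℝ ℓ} (isSubfield : IsSubfield K) where
  open IsSubfield isSubfield renaming (resp to ≈-closed)

  ℕ-closed : ∀ n → fromℤ (+ n) ∈ K
  ℕ-closed zero    = 0-closed
  ℕ-closed (suc n) = ≈-closed (≈-pointwise λ _ → sym (ℤ→ℚ-homo-+ 1ℤ (+ n)))
    (+-closed 1-closed (ℕ-closed n))

  ℤ-closed : ∀ k → fromℤ k ∈ K
  ℤ-closed (+ n)    = ℕ-closed n
  ℤ-closed -[1+ n ] = ≈-closed (≈-pointwise λ _ → sym (ℤ→ℚ-homo‿- (+ suc n)))
    (neg-closed (ℕ-closed (suc n)))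

  -- A rational is an integer times the inverse of a positive integer, and integers arise from 0 and
  -- 1 by addition and negation.
  ℚ-closed : ∀ q → fromℚ q ∈ K
  ℚ-closed q =
    let d , 0<d , (j , d≡j) , (k , dq≡k) , _ = common-denominator q 0ℚ
        r , dr≡1 = reciprocal (λ d≡0 → ℚ.<-irrefl (sym d≡0) 0<d)
    in ≈-closed (≈-pointwise λ _ → quotient d k r dq≡k dr≡1) (*-closed (ℤ-closed k)
         (inv-closed {x = fromℤ j} {y = fromℚ r} (ℤ-closed j)
           (≈-pointwise λ _ → trans (cong (ℚ._* r) (sym d≡j)) dr≡1)))
    where
    open ≡-Reasoning
    quotient : ∀ d k r → d ℚ.* q ≡ ℤ→ℚ k → d ℚ.* r ≡ 1ℚ → ℤ→ℚ k ℚ.* r ≡ q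
    quotient d k r dq≡k dr≡1 = begin
      ℤ→ℚ k ℚ.* r      ≡⟨ cong (ℚ._* r) dq≡k ⟨
      d ℚ.* q ℚ.* r    ≡⟨ solve 3 (λ d q r → d :* q :* r := d :* r :* q) refl d q r ⟩
      d ℚ.* r ℚ.* q    ≡⟨ cong (ℚ._* q) dr≡1 ⟩
      1ℚ ℚ.* q         ≡⟨ ℚ.*-identityˡ q ⟩
      q                ∎

  affine-closed : ∀ {x y} q r → x ≈ fromℚ q + fromℚ r * y → y ∈ K → x ∈ K
  affine-closed q r x≈ y∈K =
    ≈-closed (≈-sym x≈) (+-closed (ℚ-closed q) (*-closed (ℚ-closed r) y∈K))

  ℚ⟮⟯-⊆ : ∀ {α} → α ∈ K → ∀ {x} → x ∈ ℚ⟮ α ⟯ → x ∈ K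
  ℚ⟮⟯-⊆ α∈K gen          = α∈K
  ℚ⟮⟯-⊆ α∈K (rat q)      = ℚ-closed q
  ℚ⟮⟯-⊆ α∈K (resp x≈y h) = ≈-closed x≈y (ℚ⟮⟯-⊆ α∈K h)
  ℚ⟮⟯-⊆ α∈K (add h h′)   = +-closed (ℚ⟮⟯-⊆ α∈K h) (ℚ⟮⟯-⊆ α∈K h′)
  ℚ⟮⟯-⊆ α∈K (neg h)      = neg-closed (ℚ⟮⟯-⊆ α∈K h)
  ℚ⟮⟯-⊆ α∈K (mul h h′)   = *-closed (ℚ⟮⟯-⊆ α∈K h) (ℚ⟮⟯-⊆ α∈K h′)
  ℚ⟮⟯-⊆ α∈K (inv h xy≈1) = inv-closed (ℚ⟮⟯-⊆ α∈K h) xy≈1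

AffineSpan : ℝ → ℝ → Set
AffineSpan θ x = ∃[ u ] ∃[ w ] x ≈ fromℚ u + fromℚ w * θ

affineSpan-⊆-ℚ⟮⟯ : ∀ {α x} → AffineSpan α x → x ∈ ℚ⟮ α ⟯
affineSpan-⊆-ℚ⟮⟯ (u , w , x≈) = resp (≈-sym x≈) (add (rat u) (mul (rat w) gen))

affineSpan-trans : ∀ {α θ x} → AffineSpan α θ → AffineSpan θ x → AffineSpan α x
affineSpan-trans {α} {θ} {x} (s , t , θ≈) (u , w , x≈) =
  u ℚ.+ w ℚ.* s , w ℚ.* t , ≈-combine₂ 1ℝ (fromℚ w) x≈ θ≈ λ n →
    solve 7 (λ α θ x s t u w → x :- (u :+ w :* s :+ w :* t :* α) :=
      con 1ℚ :* (x :- (u :+ w :* θ)) :+ w :* (θ :- (s :+ t :* α))) refl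
      (seq α n) (seq θ n) (seq x n) s t u w

-- In a basis x , y in which 1 has a nonzero coordinate along y, the element y can be
-- exchanged for 1.
module Exchange {x y : ℝ} (c d : ℚ) (d≢0 : d ≢ 0ℚ) (1≈ : 1ℝ ≈ fromℚ c * x + fromℚ d * y) where

  -- If `x` were the rational `s`, then `x - s (c x + d y) = 0` would be a relation in the basis.
  -- Its coefficient of `y` gives `s = 0`, and its coefficient of `x` then gives 1 = 0.
  exchange-irrational : (∀ p q → fromℚ p * x + fromℚ q * y ≈ 0ℝ → p ≡ 0ℚ × q ≡ 0ℚ) → Irrational x
  exchange-irrational independent s x≈s = ℚ.1≢0 (begin
    1ℚ                            ≡⟨ solve 2 (λ s c → con 1ℚ := (con 1ℚ :- s :* c) :+ s :* c) refl s c ⟩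
    1ℚ ℚ.- s ℚ.* c ℚ.+ s ℚ.* c    ≡⟨ cong₂ (λ e s → e ℚ.+ s ℚ.* c) (proj₁ zeros) s≡0 ⟩
    0ℚ ℚ.+ 0ℚ ℚ.* c               ≡⟨ solve 1 (λ c → con 0ℚ :+ con 0ℚ :* c := con 0ℚ) refl c ⟩
    0ℚ                            ∎)
    where
    open ≡-Reasoning
    zeros : 1ℚ ℚ.- s ℚ.* c ≡ 0ℚ × ℚ.- (s ℚ.* d) ≡ 0ℚ
    zeros = independent (1ℚ ℚ.- s ℚ.* c) (ℚ.- (s ℚ.* d)) (≈-combine₂ 1ℝ (fromℚ s) x≈s 1≈ λ n →
      solve 5 (λ x y c d s → (con 1ℚ :- s :* c) :* x :+ (:- (s :* d)) :* y :- con 0ℚ :=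
        con 1ℚ :* (x :- s) :+ s :* (con 1ℚ :- (c :* x :+ d :* y))) refl (seq x n) (seq y n) c d s)
    s≡0 : s ≡ 0ℚ
    s≡0 = let r , dr≡1 = reciprocal d≢0 in begin
      s                                ≡⟨ ℚ.*-identityʳ s ⟨
      s ℚ.* 1ℚ                         ≡⟨ cong (s ℚ.*_) dr≡1 ⟨
      s ℚ.* (d ℚ.* r)                  ≡⟨ solve 3 (λ s d r → s :* (d :* r) := (:- (:- (s :* d))) :* r) refl s d r ⟩
      ℚ.- (ℚ.- (s ℚ.* d)) ℚ.* r        ≡⟨ cong (λ e → ℚ.- e ℚ.* r) (proj₂ zeros) ⟩
      ℚ.- 0ℚ ℚ.* r                     ≡⟨ solve 1 (λ r → (:- con 0ℚ) :* r := con 0ℚ) refl r ⟩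
      0ℚ                               ∎

  -- Substitutes `y = r (1 - c x)`, where `r` is the reciprocal of `d`.
  exchange-spans : ∀ {z} p q → z ≈ fromℚ p * x + fromℚ q * y → AffineSpan x z
  exchange-spans {z} p q z≈ =
    let r , dr≡1 = reciprocal d≢0 in
    q ℚ.* r , p ℚ.- q ℚ.* r ℚ.* c , ≈-combine₂ 1ℝ (fromℚ (ℚ.- (q ℚ.* r))) z≈ 1≈ λ n →
      identity r dr≡1 (seq x n) (seq y n) (seq z n)
    where
    open ≡-Reasoning
    identity : ∀ r → d ℚ.* r ≡ 1ℚ → ∀ x y z →
      z ℚ.- (q ℚ.* r ℚ.+ (p ℚ.- q ℚ.* r ℚ.* c) ℚ.* x) ≡
      1ℚ ℚ.* (z ℚ.- (p ℚ.* x ℚ.+ q ℚ.* y)) ℚ.+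
        ℚ.- (q ℚ.* r) ℚ.* (1ℚ ℚ.- (c ℚ.* x ℚ.+ d ℚ.* y))
    identity r dr≡1 x y z = begin
      z ℚ.- (q ℚ.* r ℚ.+ (p ℚ.- q ℚ.* r ℚ.* c) ℚ.* x)
        -- The solver cannot use `d * r ≡ 1ℚ`, so a factor 1 is exposed on `q * y` for the rewriting
        -- that follows.
        ≡⟨ solve 7 (λ p q r c x y z → z :- (q :* r :+ (p :- q :* r :* c) :* x) :=
             (z :- (q :* r :+ (p :- q :* r :* c) :* x) :- q :* y) :+ q :* y :* con 1ℚ) refl p q r c x y z ⟩
      z ℚ.- (q ℚ.* r ℚ.+ (p ℚ.- q ℚ.* r ℚ.* c) ℚ.* x) ℚ.- q ℚ.* y ℚ.+ q ℚ.* y ℚ.* 1ℚ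
        ≡⟨ cong (λ e → z ℚ.- (q ℚ.* r ℚ.+ (p ℚ.- q ℚ.* r ℚ.* c) ℚ.* x) ℚ.- q ℚ.* y ℚ.+ q ℚ.* y ℚ.* e)
             dr≡1 ⟨
      z ℚ.- (q ℚ.* r ℚ.+ (p ℚ.- q ℚ.* r ℚ.* c) ℚ.* x) ℚ.- q ℚ.* y ℚ.+ q ℚ.* y ℚ.* (d ℚ.* r)
        ≡⟨ solve 8 (λ p q r c d x y z →
             (z :- (q :* r :+ (p :- q :* r :* c) :* x) :- q :* y) :+ q :* y :* (d :* r) :=
             con 1ℚ :* (z :- (p :* x :+ q :* y)) :+ (:- (q :* r)) :* (con 1ℚ :- (c :* x :+ d :* y))) refl
             p q r c d x y z ⟩
      1ℚ ℚ.* (z ℚ.- (p ℚ.* x ℚ.+ q ℚ.* y)) ℚ.+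
        ℚ.- (q ℚ.* r) ℚ.* (1ℚ ℚ.- (c ℚ.* x ℚ.+ d ℚ.* y)) ∎

-- The coordinates of 1 in the basis are not both zero. The basis vector with a nonzero coordinate
-- is exchanged for 1, and the other one is θ.
irrational-generator : ∀ {ℓ} {K : Pred ℝ ℓ} → IsRealQuadraticField K →
  ∃[ θ ] θ ∈ K × Irrational θ × (∀ {z} → z ∈ K → AffineSpan θ z)
irrational-generator {K = K} isField = choose (spanning 1-closed)
  where
  open IsRealQuadraticField isField
  open IsSubfield isSubfield using (1-closed)
  v : Vec ℝ 2
  v = proj₁ degreeTwo
  open IsℚBasis (proj₂ degreeTwo)
  choose : ∃[ c ] 1ℝ ≈ linComb c v → ∃[ θ ] θ ∈ K × Irrational θ × (∀ {z} → z ∈ K → AffineSpan θ z)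
  choose = from-basis v member spanning independent
    where
    -- The basis is generalised to a variable so that it can be split into `x` and `y`.
    from-basis : ∀ v → (∀ i → lookup v i ∈ K) → (∀ {z} → z ∈ K → ∃[ c ] z ≈ linComb c v) →
      (∀ c → linComb c v ≈ 0ℝ → c ≡ 0ℚ ∷ 0ℚ ∷ []) → ∃[ c ] 1ℝ ≈ linComb c v →
      ∃[ θ ] θ ∈ K × Irrational θ × (∀ {z} → z ∈ K → AffineSpan θ z)
    from-basis (x ∷ y ∷ []) member spanning independent (c ∷ d ∷ [] , 1≈) with d ℚ.≟ 0ℚ | c ℚ.≟ 0ℚ
    ... | no d≢0 | _ = x , member zero ,
      exchange-irrational (λ p q h → zeros (independent (p ∷ q ∷ []) (≈-trans (sum p q) h))) ,
      λ z∈K → spans (spanning z∈K)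
      where
      sum : ∀ p q → linComb (p ∷ q ∷ []) (x ∷ y ∷ []) ≈ fromℚ p * x + fromℚ q * y
      sum p q = ≈-pointwise λ n → cong (p ℚ.* seq x n ℚ.+_) (ℚ.+-identityʳ (q ℚ.* seq y n))
      open Exchange c d d≢0 (≈-trans 1≈ (sum c d))
      zeros : ∀ {p q} → p ∷ q ∷ [] ≡ 0ℚ ∷ 0ℚ ∷ [] → p ≡ 0ℚ × q ≡ 0ℚ
      zeros refl = refl , refl
      spans : ∀ {z} → ∃[ c ] z ≈ linComb c (x ∷ y ∷ []) → AffineSpan x z
      spans (p ∷ q ∷ [] , z≈) = exchange-spans p q (≈-trans z≈ (sum p q))
    ... | yes _ | no c≢0 = y , member (suc zero) ,
      exchange-irrational (λ q p h → zeros (independent (p ∷ q ∷ []) (≈-trans (sum p q) h))) ,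
      λ z∈K → spans (spanning z∈K)
      where
      sum : ∀ p q → linComb (p ∷ q ∷ []) (x ∷ y ∷ []) ≈ fromℚ q * y + fromℚ p * x
      sum p q = ≈-pointwise λ n →
        solve 2 (λ s t → s :+ (t :+ con 0ℚ) := t :+ s) refl (p ℚ.* seq x n) (q ℚ.* seq y n)
      open Exchange d c c≢0 (≈-trans 1≈ (sum c d))
      zeros : ∀ {p q} → p ∷ q ∷ [] ≡ 0ℚ ∷ 0ℚ ∷ [] → q ≡ 0ℚ × p ≡ 0ℚ
      zeros refl = refl , refl
      spans : ∀ {z} → ∃[ c ] z ≈ linComb c (x ∷ y ∷ []) → AffineSpan y z
      spans (p ∷ q ∷ [] , z≈) = exchange-spans q p (≈-trans z≈ (sum p q))
    ... | yes refl | yes refl = ⊥-elim (ℚ.1≢0 (fromℚ-injective (≈-trans 1≈ (≈-pointwise λ n →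
      solve 2 (λ x y → con 0ℚ :* x :+ (con 0ℚ :* y :+ con 0ℚ) := con 0ℚ) refl (seq x n) (seq y n)))))

affineSpan-scale : ∀ {θ d} → d ≢ 0ℚ → AffineSpan (fromℚ d * θ) θ
affineSpan-scale {θ} {d} d≢0 = from-reciprocal (reciprocal d≢0)
  where
  open ≡-Reasoning
  from-reciprocal : ∃[ e ] d ℚ.* e ≡ 1ℚ → AffineSpan (fromℚ d * θ) θ
  from-reciprocal (e , de≡1) = 0ℚ , e , ≈-pointwise λ n → begin
    seq θ n                          ≡⟨ ℚ.*-identityˡ (seq θ n) ⟨
    1ℚ ℚ.* seq θ n                   ≡⟨ cong (ℚ._* seq θ n) de≡1 ⟨
    d ℚ.* e ℚ.* seq θ n              ≡⟨ solve 3 (λ d e θ → d :* e :* θ := con 0ℚ :+ e :* (d :* θ)) refl d e (seq θ n) ⟩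
    0ℚ ℚ.+ e ℚ.* (d ℚ.* seq θ n)     ∎

-- Multiplying the relation by `d²` makes `d θ` a root of `X² - (d w)X - d (d u)`.
scaled-quadraticIrrational : ∀ {θ u w d} → Irrational θ → θ * θ ≈ fromℚ u + fromℚ w * θ →
  d ≢ 0ℚ → IsInt d → IsInt (d ℚ.* u) → IsInt (d ℚ.* w) → QuadraticIrrational (fromℚ d * θ)
scaled-quadraticIrrational {θ} {u} {w} {d} irr θθ≈ d≢0 d-int du-int dw-int =
  irrational-affine {q = 0ℚ} irr d≢0 dθ≈ ,
  integral-root
    (int-resp (solve 2 (λ d w → :- (d :* w) := d :* (:- w) :- (con 0ℚ :+ con 0ℚ)) refl d w)
      (int-neg dw-int))
    (int-resp
      (solve 3 (λ d u w → :- (d :* (d :* u)) :=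
        con 0ℚ :* con 0ℚ :- con 0ℚ :* (d :* (:- w)) :+ d :* d :* (:- u)) refl d u w)
      (int-neg (int-* d-int du-int)))
    (affine-root 0ℚ d root dθ≈)
  where
  dθ≈ : fromℚ d * θ ≈ fromℚ 0ℚ + fromℚ d * θ
  dθ≈ = ≈-pointwise λ n → sym (ℚ.+-identityˡ (d ℚ.* seq θ n))
  root : IsQuadraticRoot θ (ℚ.- w) (ℚ.- u)
  root = ≈-combine 1ℝ θθ≈ λ n → solve 3 (λ θ u w →
    θ :* θ :+ (:- w) :* θ :+ (:- u) :- con 0ℚ := con 1ℚ :* (θ :* θ :- (u :+ w :* θ))) refl
    (seq θ n) u w

-- The square of θ lies in `K`, the span of 1 and θ, which yields a quadratic equation over ℚ;
-- scaling θ by a common denominator of its coefficients makes it integral and preserves the span.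
integral-generator : ∀ {ℓ} {K : Pred ℝ ℓ} → IsRealQuadraticField K →
  ∃[ β ] β ∈ K × QuadraticIrrational β × (∀ {z} → z ∈ K → AffineSpan β z)
integral-generator {K = K} isField = from-generator (irrational-generator isField)
  where
  open IsRealQuadraticField isField
  open IsSubfield isSubfield using (*-closed)
  Generator : Set _
  Generator = ∃[ β ] β ∈ K × QuadraticIrrational β × (∀ {z} → z ∈ K → AffineSpan β z)
  from-denominator : ∀ {θ u w} → θ ∈ K → Irrational θ → (∀ {z} → z ∈ K → AffineSpan θ z) →
    θ * θ ≈ fromℚ u + fromℚ w * θ →
    ∃[ d ] 0ℚ ℚ.< d × IsInt d × IsInt (d ℚ.* u) × IsInt (d ℚ.* w) → Generator
  from-denominator {θ} θ∈K irr spans θθ≈ (d , 0<d , d-int , du-int , dw-int) =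
    fromℚ d * θ , *-closed (ℚ-closed isSubfield d) θ∈K ,
    scaled-quadraticIrrational irr θθ≈ d≢0 d-int du-int dw-int ,
    λ z∈K → affineSpan-trans (affineSpan-scale d≢0) (spans z∈K)
    where
    d≢0 : d ≢ 0ℚ
    d≢0 d≡0 = ℚ.<-irrefl (sym d≡0) 0<d
  from-square : ∀ {θ} → θ ∈ K → Irrational θ → (∀ {z} → z ∈ K → AffineSpan θ z) →
    AffineSpan θ (θ * θ) → Generator
  from-square θ∈K irr spans (u , w , θθ≈) =
    from-denominator θ∈K irr spans θθ≈ (common-denominator u w)
  from-generator : ∃[ θ ] θ ∈ K × Irrational θ × (∀ {z} → z ∈ K → AffineSpan θ z) → Generator
  from-generator (θ , θ∈K , irr , spans) = from-square θ∈K irr spans (spans (*-closed θ∈K θ∈K))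

-- An integral generator β has the form `n + σ α` with α in `S²ʳ`, and `α = σ (β - n)`; hence α and
-- β generate the same field.
quadratic-field-primitive : ∀ {ℓ} (K : Pred ℝ ℓ) → IsRealQuadraticField K →
  ∃[ α ] (α ∈ S²ʳ) × IsPrimitiveElement K α
quadratic-field-primitive K isField = from-generator (integral-generator isField)
  where
  open IsRealQuadraticField isField
  from-translate : ∀ {β n} → β ∈ K → (∀ {z} → z ∈ K → AffineSpan β z) →
    ∃[ α ] α ∈ S²ʳ × ∃[ σ ] IsInt σ × σ ℚ.* σ ≡ 1ℚ × β ≈ fromℤ n + fromℚ σ * α →
    ∃[ α ] (α ∈ S²ʳ) × IsPrimitiveElement K α
  from-translate {β} {n} β∈K spans (α , α∈S , σ , _ , σσ≡1 , β≈) = α , α∈S ,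
    (λ x∈K → affineSpan-⊆-ℚ⟮⟯ (affineSpan-trans (ℤ→ℚ n , σ , β≈) (spans x∈K))) ,
    ℚ⟮⟯-⊆ isSubfield (affine-closed isSubfield (ℚ.- (σ ℚ.* ℤ→ℚ n)) σ
      (≈-combine (fromℚ (ℚ.- σ)) β≈ λ i → identity (seq α i) (seq β i) (ℤ→ℚ n)) β∈K)
    where
    open ≡-Reasoning
    identity : ∀ α β n → α ℚ.- (ℚ.- (σ ℚ.* n) ℚ.+ σ ℚ.* β) ≡ ℚ.- σ ℚ.* (β ℚ.- (n ℚ.+ σ ℚ.* α))
    identity α β n = begin
      α ℚ.- (ℚ.- (σ ℚ.* n) ℚ.+ σ ℚ.* β)
        ≡⟨ cong (ℚ._- (ℚ.- (σ ℚ.* n) ℚ.+ σ ℚ.* β)) (ℚ.*-identityˡ α) ⟨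
      1ℚ ℚ.* α ℚ.- (ℚ.- (σ ℚ.* n) ℚ.+ σ ℚ.* β)
        ≡⟨ cong (λ t → t ℚ.* α ℚ.- (ℚ.- (σ ℚ.* n) ℚ.+ σ ℚ.* β)) σσ≡1 ⟨
      σ ℚ.* σ ℚ.* α ℚ.- (ℚ.- (σ ℚ.* n) ℚ.+ σ ℚ.* β)
        ≡⟨ solve 4 (λ α β n σ → σ :* σ :* α :- ((:- (σ :* n)) :+ σ :* β) :=
             (:- σ) :* (β :- (n :+ σ :* α))) refl α β n σ ⟩
      ℚ.- σ ℚ.* (β ℚ.- (n ℚ.+ σ ℚ.* α)) ∎
  from-generator : ∃[ β ] β ∈ K × QuadraticIrrational β × (∀ {z} → z ∈ K → AffineSpan β z) →
    ∃[ α ] (α ∈ S²ʳ) × IsPrimitiveElement K α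
  from-generator (β , β∈K , qi , spans) =
    let n , ε , β∈ = classification qi in from-translate {β} {n} β∈K spans (translate-affine ε n β∈)

minus-translate : ∀ n {β} → β ∈ ((Sign.- ◃ₛ S²ʳ) +ₛ n) → ∃[ α ] α ∈ S²ʳ × β ≈ - α + fromℤ n
minus-translate n {β} (γ , (α , α∈S , γ≈-α) , β≈γ+n) =
  α , α∈S , ≈-combine₂ 1ℝ 1ℝ β≈γ+n γ≈-α λ i → solve 4 (λ α β γ n →
    β :- ((:- α) :+ n) := con 1ℚ :* (β :- (γ :+ n)) :+ con 1ℚ :* (γ :- (:- α))) refl
    (seq α i) (seq β i) (seq γ i) (ℤ→ℚ n)

translates-disjoint : ∀ (n m : ℤ) (ε δ : Sign) → (n , ε) ≢ (m , δ) →
  ((ε ◃ₛ S²ʳ) +ₛ n) ⊥ ((δ ◃ₛ S²ʳ) +ₛ m)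
translates-disjoint n m Sign.+ Sign.+ neq
  ((α , (_ , _ , (0<α , α<1) , _) , β≈α+n) , (γ , (_ , _ , (0<γ , γ<1) , _) , β≈γ+m)) =
  neq (cong (_, Sign.+) (integer-translate-unique {α} {γ} n m 0<α α<1 0<γ γ<1
    (≈-trans (≈-sym β≈α+n) β≈γ+m)))
translates-disjoint n m Sign.- Sign.- neq (β∈₁ , β∈₂) =
  let α , (_ , _ , (0<α , α<1) , _) , β≈-α+n = minus-translate n β∈₁
      γ , (_ , _ , (0<γ , γ<1) , _) , β≈-γ+m = minus-translate m β∈₂
  -- Removing the signs from `-α + n = -γ + m` gives `α + m = γ + n`, hence the exchanged order of
  -- `m` and `n`.
  in neq (cong (_, Sign.-) (sym (integer-translate-unique {α} {γ} m n 0<α α<1 0<γ γ<1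
       (≈-combine (- 1ℝ) (≈-trans (≈-sym β≈-α+n) β≈-γ+m) λ i →
         solve 4 (λ α γ m n → (α :+ m) :- (γ :+ n) :=
           (:- con 1ℚ) :* (((:- α) :+ n) :- ((:- γ) :+ m))) refl
           (seq α i) (seq γ i) (ℤ→ℚ m) (ℤ→ℚ n)))))
translates-disjoint n m Sign.+ Sign.- _ ((α , α∈S , β≈α+n) , β∈₂) =
  let γ , γ∈S , β≈-γ+m = minus-translate m β∈₂
  in S+m∩-S+n≡∅ n m α∈S γ∈S (≈-trans (≈-sym β≈α+n) β≈-γ+m)
translates-disjoint n m Sign.- Sign.+ _ (β∈₁ , (γ , γ∈S , β≈γ+m)) =
  let α , α∈S , β≈-α+n = minus-translate n β∈₁
  in S+m∩-S+n≡∅ m n γ∈S α∈S (≈-trans (≈-sym β≈γ+m) β≈-α+n)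

theorem3 : (ℓ : Level) →
    ( ( QuadraticInteger ≐ ⋃ (ℤ × Sign) (λ { (n , ε) → (ε ◃ₛ S²ʳ) +ₛ n }) )
    × ( ∀ (n m : ℤ) (ε δ : Sign) → (n , ε) ≢ (m , δ) →
    ((ε ◃ₛ S²ʳ) +ₛ n) ⊥ ((δ ◃ₛ S²ʳ) +ₛ m) ) )
    × ( ∀ (K : Pred ℝ ℓ) → IsRealQuadraticField K →
    ∃[ α ] (α ∈ S²ʳ) × IsPrimitiveElement K α )
theorem3 ℓ =
  (((λ β∈ → let n , ε , β∈′ = classification (quadraticInteger⇒irrational β∈) in (n , ε) , β∈′) ,
    λ { ((n , ε) , β∈) → irrational⇒quadraticInteger (translate-irrational ε n β∈) }) ,
   translates-disjoint) ,
  quadratic-field-primitive
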